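{- Let $k\ge 2$ be a natural number and let $S$ be a $k$-automatic subset of $\mathbb{N}$ (given by a DFA accepting the language of canonical base-$k$ expansions of its elements). There is an algorithm that determines whether both of the conditions (1) $S$ is not sparse and (2) $\gcd(S)=1$ hold, and, if so, also determines the smallest possible $N$ for which there exists $M$ such that every natural number $n\ge M$ can be expressed as a sum of at most $N$ elements of $S$, together with the corresponding smallest possible $M$ for this $N$.
   Context: $\mathbb{N}=\{0,1,2,\ldots\}$. The canonical base-$k$ expansion of $n\in\mathbb{N}$ is the word over $\{0,1,\ldots,k-1\}$ representing $n$ in base $k$ without leading zeros (the empty word for $n=0$). A set $S\subseteq\mathbb{N}$ is $k$-automatic if the language of canonical base-$k$ expansions of its elements is regular, i.e., accepted by a deterministic finite automaton (DFA); by convention expansions are read by automata starting with the least significant digit. Let $\pi_S(x)=\#\{n\le x : n\in S\}$. $S$ is sparse if there is an integer $d\ge 0$ with $\pi_S(x)=O((\log x)^d)$; otherwise $S$ is non-sparse. $\gcd(S)$ is the greatest common divisor of all elements of $S$. A sum of at most $N$ elements of $S$ is a sum $x_1+\cdots+x_i$ with $1\le i\le N$ and $x_1,\ldots,x_i\in S$ (repetitions allowed). The algorithm's input is $k$ and a DFA for $S$. -}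

module Defs where

open import Data.Digit using (Digit; Expansion; fromDigits; toDigits)
open import Data.Fin.Base using (Fin; zero; suc; toℕ)
open import Data.Fin.Subset using (Subset; _∈_)
open import Data.Fin.Subset.Properties using (_∈?_)
open import Data.List.Base using (List; []; _∷_; foldl; filter; last; length; sum; upTo)
open import Data.List.Relation.Unary.All using (All)
open import Data.Maybe.Base using (Maybe; just; nothing)
import Data.Maybe.Relation.Unary.All as Maybe
open import Data.Nat.Base using (ℕ; suc; _+_; _*_; _^_; _≤_)
open import Data.Nat.Divisibility using (_∣_)
open import Data.Nat.Logarithm using (⌊log₂_⌋)
open import Data.Product.Base using (Σ; ∃-syntax; _×_; _,_)
open import Function.Bundles using (_⇔_; Equivalence)
open import Level using (0ℓ)
open import Relation.Binary.PropositionalEquality using (_≡_; _≢_; refl; sym; trans; cong; subst)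
open import Relation.Nullary using (¬_; Dec; yes; no)
open import Relation.Nullary.Decidable using (fromWitness)
open import Relation.Unary using (Pred; Decidable)

record DFA (k : ℕ) : Set where
  field
    states    : ℕ
    start     : Fin states
    δ         : Fin states → Digit k → Fin states
    accepting : Subset states

Accepts : ∀ {k} → DFA k → List (Digit k) → Set
Accepts A w = foldl δ start w ∈ accepting
  where open DFA A

-- Words are least significant digit first, as for `fromDigits`, so a leading
-- zero is a zero at the end of the list.

NoLeadingZeros : ∀ {k} → Expansion k → Set
NoLeadingZeros w = Maybe.All (λ d → toℕ d ≢ 0) (last w)

IsCanonicalExpansion : ∀ {k} → ℕ → Expansion k → Set
IsCanonicalExpansion n w = fromDigits w ≡ n × NoLeadingZeros w

_Recognises_ : ∀ {k} → DFA k → Pred ℕ 0ℓ → Set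
A Recognises S = ∀ w → Accepts A w ⇔ (∃[ n ] S n × IsCanonicalExpansion n w)

stripLeadingZeros : ∀ {k} (w : Expansion k) →
                    Σ (Expansion k) (IsCanonicalExpansion (fromDigits w))
stripLeadingZeros [] = [] , refl , Maybe.nothing
stripLeadingZeros (d ∷ w) with stripLeadingZeros w
stripLeadingZeros {k} (d ∷ w) | (e ∷ v) , eq , nlz =
  d ∷ e ∷ v , cong (λ m → toℕ d + m * k) eq , nlz
stripLeadingZeros {k} (zero ∷ w) | [] , eq , _ =
  [] , cong (_* k) eq , Maybe.nothing
stripLeadingZeros {k} (suc d ∷ w) | [] , eq , _ =
  suc d ∷ [] , cong (λ m → suc (toℕ d) + m * k) eq , Maybe.just (λ ())

canonicalExpansion : ∀ {k} → 2 ≤ k → (n : ℕ) → Σ (Expansion k) (IsCanonicalExpansion n)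
canonicalExpansion {k} 2≤k n with toDigits k {fromWitness 2≤k} n
... | w , refl = stripLeadingZeros w

-- Makes the counting function of S computable without assuming that membership
-- in S is decidable.

recognised⇒decidable : ∀ {k} → 2 ≤ k → (A : DFA k) {S : Pred ℕ 0ℓ} →
                       A Recognises S → Decidable S
recognised⇒decidable 2≤k A {S} rec n
  with canonicalExpansion 2≤k n
... | w , w≡n , nlz with foldl (DFA.δ A) (DFA.start A) w ∈? DFA.accepting A
...   | no  rejected = no λ n∈S → rejected (Equivalence.from (rec w) (n , n∈S , w≡n , nlz))
...   | yes accepted with Equivalence.to (rec w) accepted
...     | m , m∈S , w≡m , _ = yes (subst S (trans (sym w≡m) w≡n) m∈S)

module _ {S : Pred ℕ 0ℓ} (S? : Decidable S) where

  π : ℕ → ℕ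
  π x = length (filter S? (upTo (suc x)))

  -- π(x) = O((log x)^d) for some d. The floor of the binary logarithm agrees with
  -- log x up to constant factors for x ≥ 2, which does not affect the O-class.

  Sparse : Set
  Sparse = ∃[ d ] ∃[ C ] ∃[ x₀ ] (∀ x → x₀ ≤ x → π x ≤ C * ⌊log₂ x ⌋ ^ d)

IsGCD : Pred ℕ 0ℓ → ℕ → Set
IsGCD S g = (∀ s → S s → g ∣ s) × (∀ d → (∀ s → S s → d ∣ s) → d ∣ g)

IsSumOfAtMost : ℕ → Pred ℕ 0ℓ → ℕ → Set
IsSumOfAtMost N S n =
  ∃[ xs ] 1 ≤ length xs × length xs ≤ N × All S xs × sum xs ≡ n

RepresentsAllFrom : Pred ℕ 0ℓ → ℕ → ℕ → Set
RepresentsAllFrom S N M = ∀ n → M ≤ n → IsSumOfAtMost N S n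

IsLeast : Pred ℕ 0ℓ → ℕ → Set
IsLeast P n = P n × (∀ m → P m → n ≤ m)

Conditions : {S : Pred ℕ 0ℓ} → Decidable S → Set
Conditions {S} S? = ¬ Sparse S? × IsGCD S 1

-- `nothing` reports that the conditions fail, `just (N , M)` that they hold and
-- that N and M are the optimal constants.

IsCorrectOutput : {S : Pred ℕ 0ℓ} → Decidable S → Maybe (ℕ × ℕ) → Set
IsCorrectOutput S? nothing = ¬ Conditions S?
IsCorrectOutput {S} S? (just (N , M)) =
  Conditions S? ×
  IsLeast (λ N′ → ∃[ M′ ] RepresentsAllFrom S N′ M′) N ×
  IsLeast (RepresentsAllFrom S N) M

{-# OPTIONS --safe #-}
module Submission where

-- Colour ℕ with finitely many colours so that the colour of n determines that of
-- d + n k and so that S is a union of colour classes. By the pigeonhole principle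
-- the sets of colours occurring at the successive lengths of expansions are
-- eventually periodic, so it is decidable whether a union of classes is nonempty
-- or cofinite. Such colourings exist for S, for the multiples of g and, via carries,
-- for sumsets.
--
-- If no accessible and co-accessible state of the automaton lies on two different
-- cycles, each edge but one out of a state lowers the number of reachable states,
-- and S is sparse. Otherwise S contains all c + p t where t has base-K digits a and
-- a + r below a fixed leading part. Sums of K - 1 such elements of equal length fill
-- an arithmetic progression with difference D = r p, and finitely many translates
-- of these progressions cover all large multiples of D, with a bounded number of
-- summands. If gcd S = 1, some sum of elements of S is 1 modulo D and supplies
-- the other residues. This bounds N, and the least N and M are found by search.

open import Defs
open import Data.Bool.Base using (true)
open import Data.Digit using (Expansion; fromDigits)
open import Data.Fin.Base using (Fin; zero; suc; toℕ; combine; fromℕ<; funToFin; finToFun)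
open import Data.Fin.Properties using (any?; combine-injective; finToFun-funToFin; fromℕ<-cong;
  pigeonhole; toℕ<n; toℕ-fromℕ<; toℕ-injective)
import Data.Fin.Properties as Fin
open import Data.Fin.Subset using (Subset; _∈_; ∣_∣)
open import Data.Fin.Subset.Properties using (_∈?_; p⊆q⇒∣p∣≤∣q∣; p⊂q⇒∣p∣<∣q∣; x∈p⇒∣p-x∣<∣p∣)
open import Data.List.Base using (List; []; _∷_; _++_; allFin; concatMap; filter; foldl; length; map;
  replicate; upTo)
import Data.List.Membership.Propositional as List
open import Data.List.Membership.Propositional.Properties
open import Data.List.Properties using (filter-≐; length-++; length-++-sucʳ; length-applyUpTo;
  length-filter; length-map; length-replicate; length-tabulate)
open import Data.List.Relation.Unary.All as All using (All; []; _∷_)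
import Data.List.Relation.Unary.All.Properties as All
open import Data.List.Relation.Unary.AllPairs using ([]; _∷_)
open import Data.List.Relation.Unary.Any as Any using (here; there)
open import Data.List.Relation.Unary.Unique.Propositional using (Unique)
import Data.List.Relation.Unary.Unique.Propositional.Properties as Unique
open import Data.Maybe.Base using (Maybe; just; nothing)
import Data.Maybe.Relation.Unary.All as Maybe
open import Data.Nat.Base
open import Data.Nat.DivMod
open import Data.Nat.Divisibility
open import Data.Nat.GCD using (gcd; gcd[m,n]∣m; gcd[m,n]∣n; gcd[m,n]≢0; gcd-greatest; gcd-GCD; module Bézout)
open import Data.Nat.Induction using (<-rec)
open import Data.Nat.ListAction using (sum)
open import Data.Nat.ListAction.Properties using (sum-++)
open import Data.Nat.Logarithm
open import Data.Nat.Properties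
open import Data.Nat.Tactic.RingSolver using (solve-∀)
open import Data.Product.Base using (Σ; ∃; ∃₂; ∃-syntax; _×_; _,_; proj₁; proj₂; swap)
open import Data.Sum.Base as Sum using (_⊎_; inj₁; inj₂)
open import Data.Vec.Base using (tabulate)
open import Data.Vec.Properties using (lookup∘tabulate; lookup⇒[]=; []=⇒lookup)
open import Function.Base using (_∘_; case_of_)
open import Function.Bundles using (Equivalence)
open import Level using (0ℓ)
open import Relation.Binary.Definitions using (tri<; tri≈; tri>)
open import Relation.Binary.PropositionalEquality
open import Relation.Nullary using (¬_; Dec; yes; no; contradiction; does)
open import Relation.Nullary.Decidable using (map′; _×-dec_; _⊎-dec_; ¬?; dec-true; decidable-stable)
open import Relation.Unary using (Pred; Decidable; _≐_)

-- Inequalities and counting in lists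

bracket : (f : ℕ → ℕ) {y : ℕ} → f 0 ≤ y → ∀ M → y < f M →
          ∃[ m ] f m ≤ y × y < f (suc m)
bracket f f0≤y zero    y<f0 = contradiction y<f0 (≤⇒≯ f0≤y)
-- The descent keeps `y` below the value just tested, so `f` may be arbitrary and need not be
-- monotone.
bracket f {y} f0≤y (suc M) y<fM with f M ≤? y
... | yes fM≤y = M , fM≤y , y<fM
... | no  fM≰y = bracket f f0≤y M (≰⇒> fM≰y)

n<k^n : ∀ {k} → 2 ≤ k → ∀ n → n < k ^ n
n<k^n 2≤k zero    = s≤s z≤n
n<k^n {k} 2≤k (suc n) = begin-strict
  suc n         ≤⟨ n<k^n 2≤k n ⟩
  k ^ n         <⟨ m<m+n (k ^ n) (≤-trans (s≤s z≤n) (n<k^n 2≤k n)) ⟩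
  k ^ n + k ^ n ≡⟨ cong (k ^ n +_) (+-identityʳ (k ^ n)) ⟨
  2 * k ^ n     ≤⟨ *-monoˡ-≤ (k ^ n) 2≤k ⟩
  k * k ^ n     ∎
  where open ≤-Reasoning

^-distribʳ-* : ∀ r m n → (m * n) ^ r ≡ m ^ r * n ^ r
^-distribʳ-* zero    m n = refl
^-distribʳ-* (suc r) m n = begin
  m * n * (m * n) ^ r       ≡⟨ cong (m * n *_) (^-distribʳ-* r m n) ⟩
  m * n * (m ^ r * n ^ r)   ≡⟨ [m*n]*[o*p]≡[m*o]*[n*p] m n (m ^ r) (n ^ r) ⟩
  m * m ^ r * (n * n ^ r)   ∎
  where open ≡-Reasoning

-- For `m` a power `2 ^ j` the claim reduces to the exponents: `A + j * d ≤ 2 ^ j`. With `j = i + i`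
-- the right side is the square of `2 ^ i` and exceeds `suc i * i`, which bounds the left side
-- because `i` is at least `A` and at least `2 * d`.
exponential-dominates : ∀ A d x₀ → ∃[ m ] x₀ ≤ m × 1 ≤ m × A * m ^ d < 2 ^ m
exponential-dominates A d x₀ = m , x₀≤m , 1≤m , (begin-strict
  A * (2 ^ j) ^ d     ≡⟨ cong (A *_) (^-*-assoc 2 j d) ⟩
  A * 2 ^ (j * d)     <⟨ *-monoˡ-< (2 ^ (j * d)) {{m^n≢0 2 (j * d)}} (n<k^n ≤-refl A) ⟩
  2 ^ A * 2 ^ (j * d) ≡⟨ ^-distribˡ-+-* 2 A (j * d) ⟨
  2 ^ (A + j * d)     ≤⟨ ^-monoʳ-≤ 2 exponent ⟩
  2 ^ 2 ^ j           ∎)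
  where
  open ≤-Reasoning
  i = x₀ + (A + 2 * d)
  j = i + i
  m = 2 ^ j
  1≤m : 1 ≤ m
  1≤m = >-nonZero⁻¹ (2 ^ j) {{m^n≢0 2 j}}
  x₀≤m : x₀ ≤ m
  x₀≤m = begin
    x₀    ≤⟨ m≤m+n x₀ (A + 2 * d) ⟩
    i     ≤⟨ m≤m+n i i ⟩
    j     ≤⟨ <⇒≤ (n<k^n ≤-refl j) ⟩
    2 ^ j ∎
  regroup : ∀ A i d → A + (i + i) * d ≡ A + i * (2 * d)
  regroup = solve-∀
  exponent : A + j * d ≤ 2 ^ j
  exponent = begin
    A + (i + i) * d ≡⟨ regroup A i d ⟩
    A + i * (2 * d) ≤⟨ +-mono-≤ (≤-trans (m≤m+n A (2 * d)) (m≤n+m _ x₀))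
                         (*-monoʳ-≤ i (≤-trans (m≤n+m (2 * d) A) (m≤n+m _ x₀))) ⟩
    suc i * i       ≤⟨ *-mono-≤ (n<k^n ≤-refl i) (<⇒≤ (n<k^n ≤-refl i)) ⟩
    2 ^ i * 2 ^ i   ≡⟨ ^-distribˡ-+-* 2 i i ⟨
    2 ^ (i + i)     ∎

Unique-⊆⇒length-≤ : ∀ {A : Set} {xs ys : List A} → Unique xs →
                    (∀ {x} → x List.∈ xs → x List.∈ ys) → length xs ≤ length ys
Unique-⊆⇒length-≤ [] _ = z≤n
Unique-⊆⇒length-≤ {xs = x ∷ xs} (x∉xs ∷ unique) sub with ∈-∃++ (sub (here refl))
... | as , bs , refl = ≤-trans (s≤s (Unique-⊆⇒length-≤ unique remaining))
                         (≤-reflexive (sym (length-++-sucʳ as x bs)))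
  where
  remaining : ∀ {y} → y List.∈ xs → y List.∈ as ++ bs
  remaining y∈xs with ∈-++⁻ as (sub (there y∈xs))
  ... | inj₁ y∈as         = ∈-++⁺ˡ y∈as
  ... | inj₂ (here refl)  = contradiction refl (All.lookup x∉xs y∈xs)
  ... | inj₂ (there y∈bs) = ∈-++⁺ʳ as y∈bs

module _ {A B : Set} (f : A → List B) where

  length-concatMap-≤ : ∀ {b xs} → All (λ x → length (f x) ≤ b) xs →
                       length (concatMap f xs) ≤ length xs * b
  length-concatMap-≤ [] = z≤n
  length-concatMap-≤ {xs = x ∷ xs} (fx≤b ∷ rest) =
    ≤-trans (≤-reflexive (length-++ (f x))) (+-mono-≤ fx≤b (length-concatMap-≤ rest))

  -- `H` marks an entry that may exceed `b`. Once it has been met, the entries after it differ from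
  -- it and are light, so `c` is paid at most once.
  length-concatMap-exceptional : ∀ {b c} {H : A → Set} → (∀ {x y} → H x → H y → x ≡ y) →
    (∀ x → length (f x) ≤ b ⊎ H x × length (f x) ≤ c) →
    ∀ {xs} → Unique xs → length (concatMap f xs) ≤ length xs * b + c
  length-concatMap-exceptional unique bound [] = z≤n
  length-concatMap-exceptional {b} {c} unique bound {x ∷ xs} (x∉xs ∷ uxs) with bound x
  ... | inj₁ light = begin
    length (f x ++ concatMap f xs)         ≡⟨ length-++ (f x) ⟩
    length (f x) + length (concatMap f xs) ≤⟨ +-mono-≤ light
                                                (length-concatMap-exceptional unique bound uxs) ⟩
    b + (length xs * b + c)                ≡⟨ +-assoc b _ c ⟨
    b + length xs * b + c                  ∎
    where open ≤-Reasoning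
  ... | inj₂ (hx , heavy) = begin
    length (f x ++ concatMap f xs)         ≡⟨ length-++ (f x) ⟩
    length (f x) + length (concatMap f xs) ≤⟨ +-mono-≤ heavy (length-concatMap-≤ (All.map light x∉xs)) ⟩
    c + length xs * b                      ≤⟨ +-monoʳ-≤ c (m≤n+m (length xs * b) b) ⟩
    c + (b + length xs * b)                ≡⟨ +-comm c _ ⟩
    b + length xs * b + c                  ∎
    where
    open ≤-Reasoning
    light : ∀ {y} → x ≢ y → length (f y) ≤ b
    light {y} x≢y with bound y
    ... | inj₁ p        = p
    ... | inj₂ (hy , _) = contradiction (unique hx hy) x≢y

-- Subsets of a finite set coded as numbers

funToFin-cong : ∀ {m n} {f g : Fin m → Fin n} → (∀ i → f i ≡ g i) → funToFin f ≡ funToFin g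
funToFin-cong {zero}  f≗g = refl
funToFin-cong {suc m} f≗g = cong₂ combine (f≗g zero) (funToFin-cong (f≗g ∘ suc))

bit : {A : Set} → Dec A → Fin 2
bit (yes _) = suc zero
bit (no _)  = zero

bit-ext : {A B : Set} (A? : Dec A) (B? : Dec B) → (A → B) → (B → A) → bit A? ≡ bit B?
bit-ext (yes a) (yes b) _ _ = refl
bit-ext (yes a) (no ¬b) f _ = contradiction (f a) ¬b
bit-ext (no ¬a) (yes b) _ g = contradiction (g b) ¬a
bit-ext (no ¬a) (no ¬b) _ _ = refl

bit-injective : {A B : Set} (A? : Dec A) (B? : Dec B) → bit A? ≡ bit B? → A → B
bit-injective _       (yes b) _  _ = b
bit-injective (yes a) (no ¬b) () _
bit-injective (no ¬a) (no ¬b) _  a = contradiction a ¬a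

-- The characteristic function packed into one number, so that sets of colours can be compared by
-- the pigeonhole principle and can serve as colours themselves.
code : ∀ {m} {P : Fin m → Set} → Decidable P → Fin (2 ^ m)
code P? = funToFin (bit ∘ P?)

module _ {m} {P Q : Fin m → Set} {P? : Decidable P} {Q? : Decidable Q} where

  code-ext : (∀ i → P i → Q i) → (∀ i → Q i → P i) → code P? ≡ code Q?
  code-ext P⊆Q Q⊆P = funToFin-cong λ i → bit-ext (P? i) (Q? i) (P⊆Q i) (Q⊆P i)

  code-injective : code P? ≡ code Q? → ∀ i → P i → Q i
  code-injective eq i = bit-injective (P? i) (Q? i) (begin
    bit (P? i)                    ≡⟨ finToFun-funToFin (bit ∘ P?) i ⟨
    finToFun (code P?) i         ≡⟨ cong (λ c → finToFun c i) eq ⟩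
    finToFun (code Q?) i         ≡⟨ finToFun-funToFin (bit ∘ Q?) i ⟩
    bit (Q? i)                    ∎)
    where open ≡-Reasoning

m+n*k≡0 : ∀ {m n k} .{{_ : NonZero k}} → m + n * k ≡ 0 → m ≡ 0 × n ≡ 0
m+n*k≡0 {m} {n} {k} eq = m+n≡0⇒m≡0 m eq , m*n≡0⇒m≡0 n k (m+n≡0⇒n≡0 m eq)

_⊕_ : Pred ℕ 0ℓ → Pred ℕ 0ℓ → Pred ℕ 0ℓ
(X ⊕ Y) n = ∃₂ λ a b → X a × Y b × a + b ≡ n

regroup-digits : ∀ a₀ b₀ c a₁ b₁ k →
  a₀ + b₀ + c + (a₁ + b₁) * k ≡ a₀ + a₁ * k + (b₀ + b₁ * k) + c
regroup-digits = solve-∀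

regroup-carry : ∀ d c a b k → d + c * k + (a + b) * k ≡ d + (a + b + c) * k
regroup-carry = solve-∀

-- Colourings and decision procedures

module Base (k : ℕ) (2≤k : 2 ≤ k) where

  instance
    k≢0 : NonZero k
    k≢0 = >-nonZero (≤-trans (s≤s z≤n) 2≤k)

  splitDigit : ∀ n → ∃₂ λ (d : Fin k) q → n ≡ toℕ d + q * k
  splitDigit n with n divMod k
  ... | result q d eq = d , q , eq

  digit-unique : ∀ (d e : Fin k) {q r} → toℕ d + q * k ≡ toℕ e + r * k → d ≡ e × q ≡ r
  digit-unique d e {q} {r} eq = d≡e , *-cancelʳ-≡ q r k (+-cancelˡ-≡ (toℕ d) _ _
      (trans eq (cong (λ c → toℕ c + r * k) (sym d≡e))))
    where
    residue : ∀ (c : Fin k) p → (toℕ c + p * k) % k ≡ toℕ c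
    residue c p = trans ([m+kn]%n≡m%n (toℕ c) p k) (m<n⇒m%n≡m (toℕ<n c))
    d≡e : d ≡ e
    d≡e = toℕ-injective (trans (sym (residue d q)) (trans (cong (_% k) eq) (residue e r)))

  -- A map from ℕ to a finite set such that the colour of n determines the colour
  -- of d + n k: up to the choice of a transition function, this is a finite
  -- automaton reading the most significant digit first.
  record Colouring : Set where
    field
      size   : ℕ
      colour : ℕ → Fin size
      step   : ∀ (d : Fin k) {m n} → colour m ≡ colour n →
               colour (toℕ d + m * k) ≡ colour (toℕ d + n * k)

  -- By `respects`, `X` is a union of colour classes. This alone does not decide an arbitrary
  -- predicate, hence the field `X?`.
  record Automatic (X : Pred ℕ 0ℓ) : Set where
    field
      colouring : Colouring
    open Colouring colouring public
    field
      respects : ∀ {m n} → colour m ≡ colour n → X m → X n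
      X?       : Decidable X

  -- Level `L` means `L + 1` digits; 0 has no level.
  record HasLevel (L n : ℕ) : Set where
    constructor _,_
    field
      ≤level : k ^ L ≤ n
      level< : n < k ^ suc L
  open HasLevel

  level? : ∀ L n → Dec (HasLevel L n)
  level? L n = map′ (λ (lo , hi) → lo , hi) (λ (lo , hi) → lo , hi) (k ^ L ≤? n ×-dec n <? k ^ suc L)

  level-of : ∀ {n} → 1 ≤ n → ∃[ L ] HasLevel L n
  level-of {n} 1≤n with bracket (k ^_) 1≤n n (n<k^n 2≤k n)
  ... | L , lo , hi = L , lo , hi

  level-suc : ∀ {L n} (d : Fin k) → HasLevel L n → HasLevel (suc L) (toℕ d + n * k)
  level-suc {L} {n} d (lo , hi) = lower , upper
    where
    open ≤-Reasoning
    lower : k * k ^ L ≤ toℕ d + n * k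
    lower = begin
      k * k ^ L     ≡⟨ *-comm k (k ^ L) ⟩
      k ^ L * k     ≤⟨ *-monoˡ-≤ k lo ⟩
      n * k         ≤⟨ m≤n+m (n * k) (toℕ d) ⟩
      toℕ d + n * k ∎
    upper : toℕ d + n * k < k * k ^ suc L
    upper = begin-strict
      toℕ d + n * k   <⟨ +-monoˡ-< (n * k) (toℕ<n d) ⟩
      suc n * k       ≤⟨ *-monoˡ-≤ k hi ⟩
      k ^ suc L * k   ≡⟨ *-comm (k ^ suc L) k ⟩
      k * k ^ suc L   ∎

  level-pred : ∀ {L n} (d : Fin k) → HasLevel (suc L) (toℕ d + n * k) → HasLevel L n
  level-pred {L} {n} d (lo , hi) = lower , *-cancelʳ-< k n (k ^ suc L) upper
    where
    open ≤-Reasoning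
    lower : k ^ L ≤ n
    lower = s≤s⁻¹ (*-cancelʳ-< k (k ^ L) (suc n) (begin-strict
      k ^ L * k     ≡⟨ *-comm (k ^ L) k ⟩
      k * k ^ L     ≤⟨ lo ⟩
      toℕ d + n * k <⟨ +-monoˡ-< (n * k) (toℕ<n d) ⟩
      suc n * k     ∎))
    upper : n * k < k ^ suc L * k
    upper = begin-strict
      n * k         ≤⟨ m≤n+m (n * k) (toℕ d) ⟩
      toℕ d + n * k <⟨ hi ⟩
      k * k ^ suc L ≡⟨ *-comm k (k ^ suc L) ⟩
      k ^ suc L * k ∎

  level-mono : ∀ {L L′ n n′} → L < L′ → HasLevel L n → HasLevel L′ n′ → n < n′
  level-mono L<L′ (_ , n<) (≤n′ , _) = <-≤-trans n< (≤-trans (^-monoʳ-≤ k L<L′) ≤n′)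

  module Periodicity (C : Colouring) where
    open Colouring C

    Occurs : ℕ → Fin size → Set
    Occurs L v = ∃[ n ] HasLevel L n × colour n ≡ v

    occurs? : ∀ L → Decidable (Occurs L)
    occurs? L v = map′
      (λ (n , _ , p) → n , p)
      (λ (n , lev , eq) → n , level< lev , lev , eq)
      (anyUpTo? (λ n → level? L n ×-dec colour n Fin.≟ v) (k ^ suc L))

    -- The numbers of the next level arise by appending a last digit, and the new colour depends
    -- only on that digit and the old colour. Hence an inclusion between the colour sets of two
    -- levels persists.
    occurs-shift : ∀ {i j} → (∀ v → Occurs i v → Occurs j v) →
                   ∀ t v → Occurs (t + i) v → Occurs (t + j) v
    occurs-shift sub zero    v occ = sub v occ
    occurs-shift sub (suc t) v (n , lev , refl) with splitDigit n
    ... | d , q , refl with occurs-shift sub t (colour q) (q , level-pred d lev , refl)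
    ...   | q′ , lev′ , eq = toℕ d + q′ * k , level-suc d lev′ , step d eq

    -- The colour sets of two levels i < j coincide by the pigeonhole principle,
    -- and then those of t + i and t + j do.
    periodic : ∃₂ λ lo hi →
      (∀ {n} → hi ≤ n → ∃[ n′ ] n′ < n × lo ≤ n′ × colour n′ ≡ colour n) ×
      (∀ {n} → lo ≤ n → ∃[ n′ ] n < n′ × colour n′ ≡ colour n)
    periodic with pigeonhole (n<1+n (2 ^ size)) (λ L → code (occurs? (toℕ L)))
    ... | I , J , i<j , same = k ^ i , k ^ j , lower , raise
      where
      i = toℕ I
      j = toℕ J
      positive : ∀ {L n} → k ^ L ≤ n → 1 ≤ n
      positive {L} = ≤-trans (>-nonZero⁻¹ (k ^ L) {{m^n≢0 k L}})
      offset : ∀ {L M n} → k ^ M ≤ n → HasLevel L n → ∃[ t ] t + M ≡ L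
      offset {L} {M} k^M≤n (_ , n<) with M ≤? L
      ... | yes M≤L = L ∸ M , m∸n+n≡m M≤L
      ... | no  M≰L = contradiction (≤-trans (^-monoʳ-≤ k (≰⇒> M≰L)) k^M≤n) (<⇒≱ n<)
      lower : ∀ {n} → k ^ j ≤ n → ∃[ n′ ] n′ < n × k ^ i ≤ n′ × colour n′ ≡ colour n
      lower {n} j≤n with level-of (positive {j} j≤n)
      ... | L , lev with offset {L} {j} j≤n lev
      ...   | t , refl with occurs-shift {j} {i} (code-injective (sym same)) t _ (n , lev , refl)
      ...     | n′ , lev′ , eq = n′ , level-mono (+-monoʳ-< t i<j) lev′ lev ,
                                 ≤-trans (^-monoʳ-≤ k (m≤n+m i t)) (≤level lev′) , eq
      raise : ∀ {n} → k ^ i ≤ n → ∃[ n′ ] n < n′ × colour n′ ≡ colour n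
      raise {n} i≤n with level-of (positive {i} i≤n)
      ... | L , lev with offset {L} {i} i≤n lev
      ...   | t , refl with occurs-shift {i} {j} (code-injective same) t _ (n , lev , refl)
      ...     | n′ , lev′ , eq = n′ , level-mono (+-monoʳ-< t i<j) lev lev′ , eq

  module _ {X : Pred ℕ 0ℓ} (A : Automatic X) where
    open Automatic A
    open Periodicity colouring

    -- A member from `hi` on can be replaced by a smaller number of the same colour, so a search
    -- below `hi` suffices.
    inhabited? : Dec (∃ X)
    inhabited? with periodic
    ... | _ , hi , lower , _ = map′ (λ (n , _ , x) → n , x) (λ (n , x) → descend n x)
                                    (anyUpTo? X? hi)
      where
      descend : ∀ n → X n → ∃[ n′ ] n′ < hi × X n′
      descend = <-rec _ λ n rec x → case hi ≤? n of λ where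
        (no hi≰n)  → n , ≰⇒> hi≰n , x
        (yes hi≤n) → let n′ , n′<n , _ , eq = lower hi≤n in rec n′<n (respects (sym eq) x)

    -- It suffices to search between `lo` and `hi`. A non-member there recurs with the same colour
    -- beyond every bound; if there is none, lowering numbers within their colour shows that
    -- everything from `lo` on is a member.
    cofinite? : Dec (∃[ M ] (∀ n → M ≤ n → X n))
    cofinite? with periodic
    ... | lo , hi , lower , raise with anyUpTo? (λ n → lo ≤? n ×-dec ¬? (X? n)) hi
    ...   | yes (n , _ , lo≤n , ¬x) = no λ (M , all) →
              let n′ , M≤n′ , _ , ¬x′ = climb M in ¬x′ (all n′ M≤n′)
      where
      climb : ∀ M → ∃[ n ] M ≤ n × lo ≤ n × ¬ X n
      climb zero    = n , z≤n , lo≤n , ¬x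
      climb (suc M) with climb M
      ... | m , M≤m , lo≤m , ¬xm with raise lo≤m
      ...   | n′ , m<n′ , eq =
        n′ , ≤-<-trans M≤m m<n′ , ≤-trans lo≤m (<⇒≤ m<n′) , ¬xm ∘ respects eq
    ...   | no none = yes (lo , <-rec _ λ n rec lo≤n → case hi ≤? n of λ where
        (no hi≰n)  → decidable-stable (X? n) λ ¬x → none (n , ≰⇒> hi≰n , lo≤n , ¬x)
        (yes hi≤n) → let n′ , n′<n , lo≤n′ , eq = lower hi≤n in respects eq (rec n′<n lo≤n′))

  automatic-⇔ : ∀ {X Y : Pred ℕ 0ℓ} → (∀ n → X n → Y n) → (∀ n → Y n → X n) →
                Automatic X → Automatic Y
  automatic-⇔ X⊆Y Y⊆X A = record
    { colouring = colouring
    ; respects  = λ eq y → X⊆Y _ (respects eq (Y⊆X _ y))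
    ; X?        = λ n → map′ (X⊆Y n) (Y⊆X n) (X? n)
    }
    where open Automatic A

  automatic-¬ : ∀ {X : Pred ℕ 0ℓ} → Automatic X → Automatic (¬_ ∘ X)
  automatic-¬ A = record
    { colouring = colouring
    ; respects  = λ eq ¬x → ¬x ∘ respects (sym eq)
    ; X?        = λ n → ¬? (X? n)
    }
    where open Automatic A

  pairColouring : Colouring → Colouring → Colouring
  pairColouring C D = record
    { size   = C.size * D.size
    ; colour = λ n → combine (C.colour n) (D.colour n)
    ; step   = λ d eq → let eqC , eqD = combine-injective _ _ _ _ eq in
                        cong₂ combine (C.step d eqC) (D.step d eqD)
    }
    where module C = Colouring C
          module D = Colouring D

  module _ {X Y : Pred ℕ 0ℓ} (A : Automatic X) (B : Automatic Y) where
    private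
      module A = Automatic A
      module B = Automatic B

    automatic-⊎ : Automatic (λ n → X n ⊎ Y n)
    automatic-⊎ = record
      { colouring = pairColouring A.colouring B.colouring
      ; respects  = λ eq → let eqA , eqB = combine-injective _ _ _ _ eq in
                           Sum.map (A.respects eqA) (B.respects eqB)
      ; X?        = λ n → A.X? n ⊎-dec B.X? n
      }

    automatic-× : Automatic (λ n → X n × Y n)
    automatic-× = record
      { colouring = pairColouring A.colouring B.colouring
      ; respects  = λ eq (x , y) → let eqA , eqB = combine-injective _ _ _ _ eq in
                                   A.respects eqA x , B.respects eqB y
      ; X?        = λ n → A.X? n ×-dec B.X? n
      }

  automatic-≡0 : Automatic (_≡ 0)
  automatic-≡0 = record
    { colouring = record
      { size   = 2
      ; colour = λ n → bit (n ≟ 0)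
      ; step   = λ d {m} {n} eq → bit-ext (_ ≟ 0) (_ ≟ 0)
          (transfer d (bit-injective (m ≟ 0) (n ≟ 0) eq))
          (transfer d (bit-injective (n ≟ 0) (m ≟ 0) (sym eq)))
      }
    ; respects  = λ {m} {n} → bit-injective (m ≟ 0) (n ≟ 0)
    ; X?        = _≟ 0
    }
    where
    transfer : ∀ (d : Fin k) {m n} → (m ≡ 0 → n ≡ 0) →
               toℕ d + m * k ≡ 0 → toℕ d + n * k ≡ 0
    transfer d {m} imp eq with m+n*k≡0 {toℕ d} {m} {k} eq
    ... | d≡0 , m≡0 = cong₂ _+_ d≡0 (cong (_* k) (imp m≡0))

  automatic-∣ : ∀ g .{{_ : NonZero g}} → Automatic (g ∣_)
  automatic-∣ g = record
    { colouring = record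
      { size   = g
      ; colour = λ n → n mod g
      ; step   = λ d {m} {n} eq → fromℕ<-cong _ _ (step d m n (residues m n eq)) _ _
      }
    ; respects  = λ {m} {n} eq g∣m →
        m%n≡0⇒n∣m n g (trans (sym (residues m n eq)) (n∣m⇒m%n≡0 m g g∣m))
    ; X?        = g ∣?_
    }
    where
    residues : ∀ m n → m mod g ≡ n mod g → m % g ≡ n % g
    residues m n eq = begin
      m % g         ≡⟨ toℕ-fromℕ< (m%n<n m g) ⟨
      toℕ (m mod g) ≡⟨ cong toℕ eq ⟩
      toℕ (n mod g) ≡⟨ toℕ-fromℕ< (m%n<n n g) ⟩
      n % g         ∎
      where open ≡-Reasoning
    step : ∀ (d : Fin k) m n → m % g ≡ n % g → (toℕ d + m * k) % g ≡ (toℕ d + n * k) % g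
    step d m n eq = begin
      (toℕ d + m * k) % g                             ≡⟨ %-distribˡ-+ (toℕ d) (m * k) g ⟩
      (toℕ d % g + m * k % g) % g                     ≡⟨ cong (λ r → (toℕ d % g + r) % g) same ⟩
      (toℕ d % g + n * k % g) % g                     ≡⟨ %-distribˡ-+ (toℕ d) (n * k) g ⟨
      (toℕ d + n * k) % g                             ∎
      where
      open ≡-Reasoning
      same : m * k % g ≡ n * k % g
      same = trans (%-distribˡ-* m k g)
               (trans (cong (λ r → (r * (k % g)) % g) eq) (sym (%-distribˡ-* n k g)))

  -- Sumsets via carries

  module _ {X Y : Pred ℕ 0ℓ} (A : Automatic X) (B : Automatic Y) where
    private
      module A = Automatic A
      module B = Automatic B

      -- Here `n`, `a` and `b` are leading parts of a sum and its two summands, and `c` is the carry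
      -- that arrives from the less significant digits. Only the colours of `a` and `b` and the
      -- carry matter; `profile n` is the set of all such triples, as in the subset construction.
      record Summands (n : ℕ) (i : Fin (A.size * (B.size * 2))) : Set where
        constructor mk
        field
          a b   : ℕ
          c     : Fin 2
          index : combine (A.colour a) (combine (B.colour b) c) ≡ i
          total : a + b + toℕ c ≡ n

      summands? : ∀ n → Decidable (Summands n)
      summands? n i = map′
        (λ (a , _ , b , _ , c , index , total) → mk a b c index total)
        (λ { (mk a b c index refl) →
             a , s≤s (≤-trans (m≤m+n a b) (m≤m+n (a + b) (toℕ c))) ,
             b , s≤s (≤-trans (m≤n+m b a) (m≤m+n (a + b) (toℕ c))) , c , index , refl })
        (anyUpTo? (λ a → anyUpTo? (λ b → any? λ c →
          combine (A.colour a) (combine (B.colour b) c) Fin.≟ i ×-dec a + b + toℕ c ≟ n)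
        (suc n)) (suc n))

      profile : ∀ n → Fin (2 ^ (A.size * (B.size * 2)))
      profile n = code (summands? n)

      match : ∀ a b c {n} → profile (a + b + toℕ c) ≡ profile n →
        ∃₂ λ a′ b′ → A.colour a ≡ A.colour a′ × B.colour b ≡ B.colour b′ × a′ + b′ + toℕ c ≡ n
      match a b c {n} eq
        with code-injective {P? = summands? (a + b + toℕ c)} {Q? = summands? n} eq _ (mk a b c refl refl)
      ... | mk a′ b′ c′ same sum with combine-injective _ _ _ _ same
      ...   | eqA , rest with combine-injective (B.colour b′) c′ (B.colour b) c rest
      ...     | eqB , refl = a′ , b′ , sym eqA , sym eqB , sum

      -- Adding the last digits a₀ and b₀ and the incoming carry c produces the last
      -- digit d and the carry c′.
      carry : ∀ (a₀ b₀ : Fin k) (c : Fin 2) (d : Fin k) {q m} →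
        toℕ a₀ + toℕ b₀ + toℕ c + q * k ≡ toℕ d + m * k →
        ∃[ c′ ] toℕ a₀ + toℕ b₀ + toℕ c ≡ toℕ d + toℕ {2} c′ * k × q + toℕ c′ ≡ m
      carry a₀ b₀ c d {q} {m} eq with splitDigit (toℕ a₀ + toℕ b₀ + toℕ c)
      ... | d′ , r , s≡ with digit-unique d′ d {r + q} {m} (begin
              toℕ d′ + (r + q) * k              ≡⟨ regroup (toℕ d′) r q k ⟩
              toℕ d′ + r * k + q * k            ≡⟨ cong (_+ q * k) s≡ ⟨
              toℕ a₀ + toℕ b₀ + toℕ c + q * k   ≡⟨ eq ⟩
              toℕ d + m * k                     ∎)
        where
        open ≡-Reasoning
        regroup : ∀ x r q k → x + (r + q) * k ≡ x + r * k + q * k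
        regroup = solve-∀
      ...   | refl , r+q≡m = fromℕ< r<2 ,
                trans s≡ (cong (λ x → toℕ d + x * k) (sym (toℕ-fromℕ< r<2))) ,
                trans (cong (q +_) (toℕ-fromℕ< r<2)) (trans (+-comm q r) r+q≡m)
        where
        open ≤-Reasoning
        r<2 : r < 2
        r<2 = *-cancelʳ-< k r 2 (begin-strict
          r * k                    ≤⟨ m≤n+m (r * k) (toℕ d) ⟩
          toℕ d + r * k            ≡⟨ s≡ ⟨
          toℕ a₀ + toℕ b₀ + toℕ c  ≤⟨ +-monoʳ-≤ (toℕ a₀ + toℕ b₀) (s≤s⁻¹ (toℕ<n c)) ⟩
          toℕ a₀ + toℕ b₀ + 1      ≡⟨ +-assoc (toℕ a₀) (toℕ b₀) 1 ⟩
          toℕ a₀ + (toℕ b₀ + 1)    ≡⟨ cong (toℕ a₀ +_) (+-comm (toℕ b₀) 1) ⟩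
          toℕ a₀ + suc (toℕ b₀)    <⟨ +-mono-<-≤ (toℕ<n a₀) (toℕ<n b₀) ⟩
          k + k                    ≡⟨ cong (k +_) (+-identityʳ k) ⟨
          2 * k                    ∎)

      -- Last digits are split off the summands, which leaves a decomposition of `m` with carry
      -- `c′`. Equality of profiles provides one of `n` with the same colours and carry, to which
      -- the old last digits are appended again.
      shift : ∀ (d : Fin k) {m n} → profile m ≡ profile n →
        ∀ i → Summands (toℕ d + m * k) i → Summands (toℕ d + n * k) i
      shift d {m} {n} eq i (mk a b c index total) =
        let a₀ , a₁ , a≡ = splitDigit a
            b₀ , b₁ , b≡ = splitDigit b
            c′ , last , rest = carry a₀ b₀ c d {a₁ + b₁} {m} (begin
              toℕ a₀ + toℕ b₀ + toℕ c + (a₁ + b₁) * k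
                ≡⟨ regroup-digits (toℕ a₀) (toℕ b₀) (toℕ c) a₁ b₁ k ⟩
              toℕ a₀ + a₁ * k + (toℕ b₀ + b₁ * k) + toℕ c
                ≡⟨ cong₂ (λ x y → x + y + toℕ c) a≡ b≡ ⟨
              a + b + toℕ c
                ≡⟨ total ⟩
              toℕ d + m * k
                ∎)
            a₂ , b₂ , eqA , eqB , total′ = match a₁ b₁ c′ {n} (trans (cong profile rest) eq)
            colourA = trans (A.step a₀ (sym eqA)) (cong A.colour (sym a≡))
            colourB = trans (B.step b₀ (sym eqB)) (cong B.colour (sym b≡))
        in mk (toℕ a₀ + a₂ * k) (toℕ b₀ + b₂ * k) c
          (trans (cong₂ (λ u v → combine u (combine v c)) colourA colourB) index)
          (begin
            toℕ a₀ + a₂ * k + (toℕ b₀ + b₂ * k) + toℕ c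
              ≡⟨ regroup-digits (toℕ a₀) (toℕ b₀) (toℕ c) a₂ b₂ k ⟨
            toℕ a₀ + toℕ b₀ + toℕ c + (a₂ + b₂) * k
              ≡⟨ cong (_+ (a₂ + b₂) * k) last ⟩
            toℕ d + toℕ c′ * k + (a₂ + b₂) * k
              ≡⟨ regroup-carry (toℕ d) (toℕ c′) a₂ b₂ k ⟩
            toℕ d + (a₂ + b₂ + toℕ c′) * k
              ≡⟨ cong (λ x → toℕ d + x * k) total′ ⟩
            toℕ d + n * k
              ∎)
        where
        open ≡-Reasoning

      profile-step : ∀ (d : Fin k) {m n} → profile m ≡ profile n →
                     profile (toℕ d + m * k) ≡ profile (toℕ d + n * k)
      profile-step d {m} {n} eq = code-ext
        {P? = summands? (toℕ d + m * k)} {Q? = summands? (toℕ d + n * k)}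
        (shift d {m} {n} eq) (shift d {n} {m} (sym eq))

      profile-respects : ∀ {m n} → profile m ≡ profile n → (X ⊕ Y) m → (X ⊕ Y) n
      profile-respects {m} {n} eq (a , b , x , y , total) =
        let a′ , b′ , eqA , eqB , total′ =
              -- No carry arrives at the least significant digit.
              match a b zero {n} (trans (cong profile (trans (+-identityʳ (a + b)) total)) eq)
        in a′ , b′ , A.respects eqA x , B.respects eqB y ,
           trans (sym (+-identityʳ (a′ + b′))) total′

      sum? : Decidable (X ⊕ Y)
      sum? n = map′
        (λ (a , _ , b , _ , x , y , total) → a , b , x , y , total)
        (λ { (a , b , x , y , refl) →
             a , s≤s (m≤m+n a b) , b , s≤s (m≤n+m b a) , x , y , refl })
        (anyUpTo? (λ a → anyUpTo? (λ b → A.X? a ×-dec B.X? b ×-dec a + b ≟ n) (suc n)) (suc n))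

    automatic-⊕ : Automatic (X ⊕ Y)
    automatic-⊕ = record
      { colouring = record
        { size   = 2 ^ (A.size * (B.size * 2))
        ; colour = profile
        ; step   = λ d {m} {n} → profile-step d {m} {n}
        }
      ; respects  = λ {m} {n} → profile-respects {m} {n}
      ; X?        = sum?
      }

-- The state graph

module _ {k : ℕ} {{_ : NonZero k}} where

  canonical-positive : ∀ (d : Fin k) w → NoLeadingZeros (d ∷ w) → fromDigits (d ∷ w) ≢ 0
  canonical-positive d []      (Maybe.just d≢0) eq = d≢0 (m+n≡0⇒m≡0 (toℕ d) eq)
  canonical-positive d (e ∷ w) nlz              eq =
    canonical-positive e w nlz (proj₂ (m+n*k≡0 {toℕ d} {fromDigits (e ∷ w)} {k} eq))

  NoLeadingZeros-tail : ∀ (d : Fin k) w → NoLeadingZeros (d ∷ w) → NoLeadingZeros w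
  NoLeadingZeros-tail d []      _   = Maybe.nothing
  NoLeadingZeros-tail d (_ ∷ _) nlz = nlz

  NoLeadingZeros-∷ : ∀ (d : Fin k) w → fromDigits w ≢ 0 → NoLeadingZeros w → NoLeadingZeros (d ∷ w)
  NoLeadingZeros-∷ d []      w≢0 _   = contradiction refl w≢0
  NoLeadingZeros-∷ d (_ ∷ _) _   nlz = nlz

-- The sets of numbers accepted from the states of an automaton reading canonical
-- expansions. The equation relating them fails for n = 0, where appending a digit
-- 0 does not change the expansion.
record StateSystem (k : ℕ) (m : ℕ) : Set₁ where
  field
    δ    : Fin m → Fin k → Fin m
    F    : Fin m → Pred ℕ 0ℓ
    F?   : ∀ q → Decidable (F q)
    down : ∀ {q d n} → 0 < n → F q (toℕ d + n * k) → F (δ q d) n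
    up   : ∀ {q d n} → 0 < n → F (δ q d) n → F q (toℕ d + n * k)

module FromDFA {k : ℕ} (2≤k : 2 ≤ k) (A : DFA k) where
  open Base k 2≤k
  open DFA A

  canonical-unique : ∀ {n} (v w : Expansion k) →
    IsCanonicalExpansion n v → IsCanonicalExpansion n w → v ≡ w
  canonical-unique []      []      _ _ = refl
  canonical-unique []      (e ∷ w) (refl , _) (eq , nlz) =
    contradiction eq (canonical-positive e w nlz)
  canonical-unique (d ∷ v) []      (eq , nlz) (refl , _) =
    contradiction eq (canonical-positive d v nlz)
  canonical-unique (d ∷ v) (e ∷ w) (refl , nlz) (eq , nlz′)
    with digit-unique e d {fromDigits w} {fromDigits v} eq
  ... | refl , eq′ = cong (d ∷_) (canonical-unique v w
          (refl , NoLeadingZeros-tail d v nlz) (eq′ , NoLeadingZeros-tail d w nlz′))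

  canon : ℕ → Expansion k
  canon n = proj₁ (canonicalExpansion 2≤k n)

  isCanonical : ∀ n → IsCanonicalExpansion n (canon n)
  isCanonical n = proj₂ (canonicalExpansion 2≤k n)

  canon-∷ : ∀ d {n} → 0 < n → canon (toℕ d + n * k) ≡ d ∷ canon n
  canon-∷ d {n} 0<n = canonical-unique _ _ (isCanonical (toℕ d + n * k))
    ( cong (λ m → toℕ d + m * k) value
    , NoLeadingZeros-∷ d (canon n) (λ eq → <⇒≢ 0<n (trans (sym eq) value)) (proj₂ (isCanonical n)))
    where
    value : fromDigits (canon n) ≡ n
    value = proj₁ (isCanonical n)

  AcceptedFrom : Fin states → Pred ℕ 0ℓ
  AcceptedFrom q n = foldl δ q (canon n) ∈ accepting

  system : StateSystem k states
  system = record
    { δ    = δ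
    ; F    = AcceptedFrom
    ; F?   = λ q n → foldl δ q (canon n) ∈? accepting
    ; down = λ {q} {d} 0<n → subst (λ w → foldl δ q w ∈ accepting) (canon-∷ d 0<n)
    ; up   = λ {q} {d} 0<n → subst (λ w → foldl δ q w ∈ accepting) (sym (canon-∷ d 0<n))
    }

  module _ {S : Pred ℕ 0ℓ} (rec : A Recognises S) where

    recognised⇒accepted : ∀ n → S n → AcceptedFrom start n
    recognised⇒accepted n s = Equivalence.from (rec (canon n)) (n , s , isCanonical n)

    accepted⇒recognised : ∀ n → AcceptedFrom start n → S n
    accepted⇒recognised n acc with Equivalence.to (rec (canon n)) acc
    ... | m , s , value , _ = subst S (trans (sym value) (proj₁ (isCanonical n))) s

module Graph {k : ℕ} (2≤k : 2 ≤ k) {m : ℕ} (system : StateSystem k m) where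
  open Base k 2≤k
  open StateSystem system

  -- Path p j c q: reading the j digits of c, padded with leading zeros, leads
  -- from p to q.
  data Path : Fin m → ℕ → ℕ → Fin m → Set where
    nil  : ∀ {q} → Path q 0 0 q
    cons : ∀ {p q j c} d → Path (δ p d) j c q → Path p (suc j) (toℕ d + c * k) q

  Reach : Fin m → Fin m → Set
  Reach p q = ∃₂ λ j c → Path p j c q

  _◅◅_ : ∀ {p q r i a j b} → Path p i a q → Path q j b r → Path p (i + j) (a + b * k ^ i) r
  _◅◅_ {b = b} nil π = subst (λ c → Path _ _ c _) (sym (*-identityʳ b)) π
  _◅◅_ {r = r} {j = j} {b = b} (cons {p} {_} {i} {c} d π) π′ =
    subst (λ e → Path p (suc (i + j)) e r) (regroup (toℕ d) c b k (k ^ i)) (cons d (π ◅◅ π′))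
    where
    regroup : ∀ d c b k K → d + (c + b * K) * k ≡ d + c * k + b * (k * K)
    regroup = solve-∀

  reach-trans : ∀ {p q r} → Reach p q → Reach q r → Reach p r
  reach-trans (_ , _ , π) (_ , _ , π′) = _ , _ , π ◅◅ π′

  path< : ∀ {p j c q} → Path p j c q → c < k ^ j
  path< nil = s≤s z≤n
  path< (cons {j = j} {c} d π) = begin-strict
    toℕ d + c * k <⟨ +-monoˡ-< (c * k) (toℕ<n d) ⟩
    suc c * k     ≤⟨ *-monoˡ-≤ k (path< π) ⟩
    k ^ j * k     ≡⟨ *-comm (k ^ j) k ⟩
    k * k ^ j     ∎
    where open ≤-Reasoning

  -- The word of a path may end in zeros, but the digits of the positive `n` come after them, so
  -- none of them is a leading zero and `up` applies at every step.
  path-up : ∀ {p j c q n} → Path p j c q → 0 < n → F q n → F p (c + n * k ^ j)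
  path-up {n = n} nil 0<n f = subst (F _) (sym (*-identityʳ n)) f
  path-up {n = n} (cons {p} {j = j} {c} d π) 0<n f =
    subst (F p) (regroup (toℕ d) c n k (k ^ j))
      (up (<-≤-trans (m<n⇒m<n*o (k ^ j) {{m^n≢0 k j}} 0<n) (m≤n+m (n * k ^ j) c)) (path-up π 0<n f))
    where
    regroup : ∀ d c n k K → d + (c + n * K) * k ≡ d + c * k + n * (k * K)
    regroup = solve-∀

  -- Warshall's algorithm: Via vs p q if some path from p to q has all its
  -- intermediate states in vs.
  Via : List (Fin m) → Fin m → Fin m → Set
  Via []       p q = p ≡ q ⊎ ∃[ d ] δ p d ≡ q
  Via (v ∷ vs) p q = Via vs p q ⊎ Via vs p v × Via vs v q

  via? : ∀ vs p q → Dec (Via vs p q)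
  via? []       p q = p Fin.≟ q ⊎-dec any? λ d → δ p d Fin.≟ q
  via? (v ∷ vs) p q = via? vs p q ⊎-dec via? vs p v ×-dec via? vs v q

  -- If `v` is the head of the list, visits to `v` inside either half are cut off. Otherwise, if
  -- both halves pass through the head, the detour between its two visits is cut out.
  via-trans : ∀ {v vs p q} → v List.∈ vs → Via vs p v → Via vs v q → Via vs p q
  via-trans (here refl) left right = inj₂ (into left , outof right)
    where
    into : ∀ {v vs p} → Via (v ∷ vs) p v → Via vs p v
    into (inj₁ via)       = via
    into (inj₂ (via , _)) = via
    outof : ∀ {v vs q} → Via (v ∷ vs) v q → Via vs v q
    outof (inj₁ via)       = via
    outof (inj₂ (_ , via)) = via
  via-trans (there v∈) (inj₁ pv)        (inj₁ vq)        = inj₁ (via-trans v∈ pv vq)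
  via-trans (there v∈) (inj₁ pv)        (inj₂ (vw , wq)) = inj₂ (via-trans v∈ pv vw , wq)
  via-trans (there v∈) (inj₂ (pw , wv)) (inj₁ vq)        = inj₂ (pw , via-trans v∈ wv vq)
  via-trans (there v∈) (inj₂ (pw , _))  (inj₂ (_ , wq))  = inj₂ (pw , wq)

  via-direct : ∀ vs {p q} → Via [] p q → Via vs p q
  via-direct []       via = via
  via-direct (_ ∷ vs) via = inj₁ (via-direct vs via)

  via⇒reach : ∀ vs {p q} → Via vs p q → Reach p q
  via⇒reach []       (inj₁ refl)         = _ , _ , nil
  via⇒reach []       (inj₂ (d , refl))   = _ , _ , cons d nil
  via⇒reach (v ∷ vs) (inj₁ via)          = via⇒reach vs via
  via⇒reach (v ∷ vs) (inj₂ (via , via′)) = reach-trans (via⇒reach vs via) (via⇒reach vs via′)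

  path⇒via : ∀ {p j c q} → Path p j c q → Via (allFin m) p q
  path⇒via nil              = via-direct (allFin m) (inj₁ refl)
  path⇒via (cons {p} d π) =
    via-trans (∈-allFin (δ p d)) (via-direct (allFin m) (inj₂ (d , refl))) (path⇒via π)

  reach? : ∀ p q → Dec (Reach p q)
  reach? p q = map′ (via⇒reach (allFin m)) (λ (_ , _ , π) → path⇒via π) (via? (allFin m) p q)

  reachable : Fin m → Subset m
  reachable p = tabulate (does ∘ reach? p)

  ∈-reachable⁺ : ∀ {p q} → Reach p q → q ∈ reachable p
  ∈-reachable⁺ {p} {q} r =
    lookup⇒[]= q _ (trans (lookup∘tabulate (does ∘ reach? p) q) (dec-true (reach? p q) r))

  ∈-reachable⁻ : ∀ {p q} → q ∈ reachable p → Reach p q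
  ∈-reachable⁻ {p} {q} q∈ = witness (reach? p q)
    (trans (sym (lookup∘tabulate (does ∘ reach? p) q)) ([]=⇒lookup q∈))
    where
    witness : ∀ {A : Set} (A? : Dec A) → does A? ≡ true → A
    witness (yes a) _ = a

  -- It never increases along an edge and drops when there is no way back. It becomes the exponent
  -- in the polynomial bound on growth.
  rank : Fin m → ℕ
  rank p = ∣ reachable p ∣

  rank-positive : ∀ p → 0 < rank p
  rank-positive p = x∈p⇒0<∣p∣ (∈-reachable⁺ (_ , _ , nil))
    where
    x∈p⇒0<∣p∣ : ∀ {n} {x : Fin n} {p} → x ∈ p → 0 < ∣ p ∣
    x∈p⇒0<∣p∣ x∈p = ≤-<-trans z≤n (x∈p⇒∣p-x∣<∣p∣ x∈p)

  rank-mono : ∀ {p q} → Reach p q → rank q ≤ rank p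
  rank-mono r = p⊆q⇒∣p∣≤∣q∣ λ q∈ → ∈-reachable⁺ (reach-trans r (∈-reachable⁻ q∈))

  rank-< : ∀ {p q} → Reach p q → ¬ Reach q p → rank q < rank p
  rank-< {p} r ¬r = p⊂q⇒∣p∣<∣q∣
    ( (λ q∈ → ∈-reachable⁺ (reach-trans r (∈-reachable⁻ q∈)))
    , p , ∈-reachable⁺ (_ , _ , nil) , ¬r ∘ ∈-reachable⁻)

  -- The states from which `n` is accepted determine those for `toℕ d + n * k` when `n` is positive,
  -- but not for `n = 0`; an additional bit keeps 0 apart.
  stateColouring : Colouring
  stateColouring = record
    { size   = 2 * 2 ^ m
    ; colour = colour
    ; step   = λ d {a} {b} eq → step d {a} {b} eq
    }
    where
    profile : ℕ → Fin (2 ^ m)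
    profile n = code (λ p → F? p n)
    colour : ℕ → Fin (2 * 2 ^ m)
    colour n = combine (bit (n ≟ 0)) (profile n)
    transfer : ∀ (d : Fin k) {a b} → 0 < a → 0 < b → profile a ≡ profile b →
               ∀ q → F q (toℕ d + a * k) → F q (toℕ d + b * k)
    transfer d {a} {b} 0<a 0<b eq q f =
      up 0<b (code-injective {P? = λ p → F? p a} {Q? = λ p → F? p b} eq (δ q d) (down 0<a f))
    nonzero : ∀ (d : Fin k) {a} → 0 < a → toℕ d + a * k ≢ 0
    nonzero d {a} 0<a eq = <⇒≢ 0<a (sym (proj₂ (m+n*k≡0 {toℕ d} {a} {k} eq)))
    step : ∀ (d : Fin k) {a b} → colour a ≡ colour b → colour (toℕ d + a * k) ≡ colour (toℕ d + b * k)
    step d {a} {b} eq with combine-injective (bit (a ≟ 0)) (profile a) (bit (b ≟ 0)) (profile b) eq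
    ... | eq₀ , eqP with a ≟ 0 | bit-injective (a ≟ 0) (b ≟ 0) eq₀ | bit-injective (b ≟ 0) (a ≟ 0) (sym eq₀)
    ...   | yes refl | f | _ = cong (λ b → colour (toℕ d + b * k)) (sym (f refl))
    ...   | no  a≢0  | _ | g = cong₂ combine
      (bit-ext (_ ≟ 0) (_ ≟ 0) (λ e → contradiction e (nonzero d 0<a)) (λ e → contradiction e (nonzero d 0<b)))
      (code-ext {P? = λ p → F? p (toℕ d + a * k)} {Q? = λ p → F? p (toℕ d + b * k)}
        (transfer d 0<a 0<b eqP) (transfer d 0<b 0<a (sym eqP)))
      where
      0<a = n≢0⇒n>0 a≢0
      0<b = n≢0⇒n>0 (a≢0 ∘ g)

  automatic-F : ∀ q → Automatic (F q)
  automatic-F q = record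
    { colouring = stateColouring
    ; respects  = λ {a} {b} eq → code-injective {P? = λ p → F? p a} {Q? = λ p → F? p b}
        (proj₂ (combine-injective (bit (a ≟ 0)) _ (bit (b ≟ 0)) _ eq)) q
    ; X?        = F? q
    }

-- Growth

module Growth {k : ℕ} (2≤k : 2 ≤ k) {m : ℕ} (system : StateSystem k m) (init : Fin m) where
  open Base k 2≤k
  open StateSystem system
  open Graph 2≤k system

  -- With a nonzero `n`, every word leading to `q` extends to a canonical expansion, even if that
  -- word ends in zeros.
  CoAccessible : Fin m → Set
  CoAccessible q = ∃[ n ] n ≢ 0 × F q n

  -- Two different cycles through one state part somewhere. The state where they part is taken as
  -- `hub`, so that the loops differ in their first digit.
  record Fork : Set where
    field
      hub        : Fin m
      accessible : Reach init hub
      exit       : CoAccessible hub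
      d e        : Fin k
      d≢e        : d ≢ e
      loop-d     : Reach (δ hub d) hub
      loop-e     : Reach (δ hub e) hub

  fork? : Dec Fork
  fork? = map′
    (λ (q , acc , exit , d , e , d≢e , loop-d , loop-e) → record
      { hub = q ; accessible = acc ; exit = exit ; d = d ; e = e
      ; d≢e = d≢e ; loop-d = loop-d ; loop-e = loop-e })
    (λ f → let open Fork f in hub , accessible , exit , d , e , d≢e , loop-d , loop-e)
    (any? λ q → reach? init q ×-dec
                inhabited? (automatic-× (automatic-¬ automatic-≡0) (automatic-F q)) ×-dec
                any? λ d → any? λ e →
                  ¬? (d Fin.≟ e) ×-dec reach? (δ q d) q ×-dec reach? (δ q e) q)

  leading? : ∀ q → Decidable (λ (e : Fin k) → 0 < toℕ e × F q (toℕ e))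
  leading? q e = 0 <? toℕ e ×-dec F? q (toℕ e)

  extend : Fin k → ℕ → ℕ
  extend d n = toℕ d + n * k

  -- The numbers of level `L` accepted from `q`. The recursion peels off the least significant
  -- digit; the base case is the leading digit, which must not be zero.
  numbers : ℕ → Fin m → List ℕ
  numbers zero    q = map toℕ (filter (leading? q) (allFin k))
  numbers (suc L) q = concatMap (λ d → map (extend d) (numbers L (δ q d))) (allFin k)

  numbers-sound : ∀ L q {n} → n List.∈ numbers L q → 0 < n × F q n
  numbers-sound zero q n∈ with ∈-map⁻ toℕ n∈
  ... | e , e∈ , refl = proj₂ (∈-filter⁻ (leading? q) {xs = allFin k} e∈)
  numbers-sound (suc L) q n∈ with Any.satisfied
    (∈-concatMap⁻ (λ d → map (extend d) (numbers L (δ q d))) {xs = allFin k} n∈)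
  ... | d , n∈′ with ∈-map⁻ (extend d) n∈′
  ...   | n , n∈″ , refl with numbers-sound L (δ q d) n∈″
  ...     | 0<n , f = <-≤-trans (m<n⇒m<n*o k 0<n) (m≤n+m (n * k) (toℕ d)) , up 0<n f

  numbers-complete : ∀ {L q n} → HasLevel L n → F q n → n List.∈ numbers L q
  numbers-complete {zero} {q} {n} (lo , hi) f =
    subst (List._∈ numbers 0 q) (toℕ-fromℕ< n<k) (∈-map⁺ toℕ
      (∈-filter⁺ (leading? q) (∈-allFin (fromℕ< n<k))
        (subst (0 <_) (sym (toℕ-fromℕ< n<k)) lo , subst (F q) (sym (toℕ-fromℕ< n<k)) f)))
    where
    n<k : n < k
    n<k = subst (n <_) (*-identityʳ k) hi
  numbers-complete {suc L} {q} {n} lev f with splitDigit n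
  ... | d , r , refl = ∈-concatMap⁺ (λ d → map (extend d) (numbers L (δ q d))) {xs = allFin k}
    (Any.map (λ { refl → ∈-map⁺ (extend d) (numbers-complete lev′ (down 0<r f)) }) (∈-allFin d))
    where
    lev′ : HasLevel L r
    lev′ = level-pred d lev
    0<r : 0 < r
    0<r = ≤-trans (>-nonZero⁻¹ (k ^ L) {{m^n≢0 k L}}) (HasLevel.≤level lev′)

  bound : ℕ → ℕ → ℕ
  bound L r = k * suc (L * k) ^ r

  length-extend : ∀ L q d → length (map (extend d) (numbers L (δ q d))) ≡ length (numbers L (δ q d))
  length-extend L q d = length-map (extend d) (numbers L (δ q d))

  length-allFin : length (allFin k) ≡ k
  length-allFin = length-tabulate {n = k} (λ i → i)

  -- The recursion for up to `k` digits that lower the rank and one that keeps it. The base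
  -- `B = suc (L * k)` grows by `k` per level, and `k * (B + k) * B ^ r` is the exact value of the
  -- left side.
  bound-suc : ∀ L r → k * bound L r + bound L (suc r) ≤ bound (suc L) (suc r)
  bound-suc L r = begin
    k * (k * B ^ r) + k * (B * B ^ r) ≡⟨ regroup k B (B ^ r) ⟩
    k * ((B + k) * B ^ r)             ≤⟨ *-monoʳ-≤ k (*-mono-≤ (≤-reflexive (+-comm B k))
                                           (^-monoˡ-≤ r (m≤n+m B k))) ⟩
    k * ((k + B) * (k + B) ^ r)       ≡⟨ cong (λ x → k * x ^ suc r) (+-suc k (L * k)) ⟩
    k * suc (suc L * k) ^ suc r       ∎
    where
    open ≤-Reasoning
    B = suc (L * k)
    regroup : ∀ k B P → k * (k * P) + k * (B * P) ≡ k * ((B + k) * P)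
    regroup = solve-∀

  -- Without forks, at most one digit keeps the rank; all the others lower it.
  length-numbers : ¬ Fork → ∀ L q → Reach init q → length (numbers L q) ≤ bound L (rank q)
  length-numbers ¬fork zero q _ = begin
    length (map toℕ (filter (leading? q) (allFin k))) ≡⟨ length-map toℕ (filter (leading? q) (allFin k)) ⟩
    length (filter (leading? q) (allFin k))           ≤⟨ length-filter (leading? q) (allFin k) ⟩
    length (allFin k)                                 ≡⟨ length-allFin ⟩
    k                                                 ≡⟨ *-identityʳ k ⟨
    k * 1                                             ≡⟨ cong (k *_) (^-zeroˡ (rank q)) ⟨
    k * 1 ^ rank q                                    ∎
    where open ≤-Reasoning
  length-numbers ¬fork (suc L) q acc with rank q in rank≡
  ... | zero  = contradiction rank≡ (<⇒≢′ (rank-positive q))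
    where
    <⇒≢′ : ∀ {n} → 0 < n → n ≢ 0
    <⇒≢′ 0<n eq = <⇒≢ 0<n (sym eq)
  ... | suc r = begin
    length (concatMap (λ d → map (extend d) (numbers L (δ q d))) (allFin k))
      ≤⟨ length-concatMap-exceptional (λ d → map (extend d) (numbers L (δ q d)))
           unique digit (Unique.allFin⁺ k) ⟩
    length (allFin k) * bound L r + bound L (suc r)
      ≡⟨ cong (λ l → l * bound L r + bound L (suc r)) length-allFin ⟩
    k * bound L r + bound L (suc r)
      ≤⟨ bound-suc L r ⟩
    bound (suc L) (suc r)
      ∎
    where
    open ≤-Reasoning
    edge : ∀ d → Reach q (δ q d)
    edge d = _ , _ , cons d nil
    Exceptional : Fin k → Set
    -- Nonemptiness supplies the exit of a fork; a digit with an empty list satisfies the small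
    -- bound trivially.
    Exceptional d = Reach (δ q d) q × ∃[ n ] n List.∈ numbers L (δ q d)
    unique : ∀ {d e} → Exceptional d → Exceptional e → d ≡ e
    unique {d} {e} (loop-d , n , n∈) (loop-e , _) = case d Fin.≟ e of λ where
      (yes d≡e) → d≡e
      (no  d≢e) → let 0<n , f = numbers-sound L (δ q d) n∈ in contradiction (record
        { hub = q ; accessible = acc
        ; exit = toℕ d + n * k
               , (λ eq → <⇒≢ 0<n (sym (proj₂ (m+n*k≡0 {toℕ d} {n} {k} eq)))) , up 0<n f
        ; d = d ; e = e ; d≢e = d≢e ; loop-d = loop-d ; loop-e = loop-e }) ¬fork
    nonempty : ∀ (xs : List ℕ) → length xs ≤ 0 ⊎ ∃[ x ] x List.∈ xs
    nonempty []      = inj₁ z≤n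
    nonempty (x ∷ _) = inj₂ (x , here refl)
    ih : ∀ d → length (map (extend d) (numbers L (δ q d))) ≤ bound L (rank (δ q d))
    ih d = ≤-trans (≤-reflexive (length-extend L q d))
             (length-numbers ¬fork L (δ q d) (reach-trans acc (edge d)))
    weaken : ∀ {r r′} → r ≤ r′ → bound L r ≤ bound L r′
    weaken r≤r′ = *-monoʳ-≤ k (^-monoʳ-≤ (suc (L * k)) r≤r′)
    digit : ∀ d → length (map (extend d) (numbers L (δ q d))) ≤ bound L r ⊎
                  Exceptional d × length (map (extend d) (numbers L (δ q d))) ≤ bound L (suc r)
    digit d with reach? (δ q d) q | nonempty (numbers L (δ q d))
    ... | no ¬back | _          = inj₁ (≤-trans (ih d) (weaken
            (s≤s⁻¹ (subst (rank (δ q d) <_) rank≡ (rank-< (edge d) ¬back)))))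
    ... | yes back | inj₁ empty =
            inj₁ (≤-trans (≤-reflexive (length-extend L q d)) (≤-trans empty z≤n))
    ... | yes back | inj₂ some  = inj₂ ((back , some) , ≤-trans (ih d) (weaken
            (subst (rank (δ q d) ≤_) rank≡ (rank-mono (edge d)))))

  -- As 0 has no level, it is listed separately, accepted or not; only an upper bound is wanted.
  numbersUpTo : ℕ → List ℕ
  numbersUpTo l = 0 ∷ concatMap (λ L → numbers L init) (upTo (suc l))

  log-bound : ∀ {x} → 2 ≤ x → 1 ≤ ⌊log₂ x ⌋
  log-bound 2≤x = ⌊log₂⌋-mono-≤ 2≤x

  ∈-numbersUpTo : ∀ {x n} → n ≤ x → F init n → n List.∈ numbersUpTo ⌊log₂ x ⌋
  ∈-numbersUpTo {x} {zero}  _   _ = here refl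
  ∈-numbersUpTo {x} {suc n} n≤x f with level-of {suc n} (s≤s z≤n)
  ... | L , lev = there (∈-concatMap⁺ (λ L → numbers L init) {xs = upTo (suc ⌊log₂ x ⌋)}
      (Any.map (λ { refl → numbers-complete lev f }) (∈-upTo⁺ (s≤s L≤log))))
    where
    open ≤-Reasoning
    L≤log : L ≤ ⌊log₂ x ⌋
    L≤log = begin
      L              ≡⟨ ⌊log₂[2^n]⌋≡n L ⟨
      ⌊log₂ 2 ^ L ⌋  ≤⟨ ⌊log₂⌋-mono-≤ (≤-trans (^-monoˡ-≤ L 2≤k) (≤-trans (HasLevel.≤level lev) n≤x)) ⟩
      ⌊log₂ x ⌋      ∎

  -- Each of the `suc l` levels contributes at most `k * (suc k * l) ^ rank init`. As `1 ≤ l`,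
  -- `suc l` is at most `2 * l`, and the entry 0 is absorbed by a power of `l`.
  length-numbersUpTo : ¬ Fork → ∀ {l} → 1 ≤ l →
    length (numbersUpTo l) ≤ (1 + 2 * (k * suc k ^ rank init)) * l ^ suc (rank init)
  length-numbersUpTo ¬fork {l} 1≤l = begin
    1 + length (concatMap (λ L → numbers L init) (upTo (suc l)))
      ≤⟨ +-monoʳ-≤ 1 (length-concatMap-≤ (λ L → numbers L init)
           (All.tabulate λ {L} L∈ → ≤-trans (length-numbers ¬fork L init (_ , _ , nil))
             (*-monoʳ-≤ k (^-monoˡ-≤ r (level-bound (s≤s⁻¹ (∈-upTo⁻ L∈))))))) ⟩
    1 + length (upTo (suc l)) * (k * (suc k * l) ^ r)
      ≡⟨ cong₂ (λ x y → 1 + x * (k * y)) (length-applyUpTo (λ i → i) (suc l)) (^-distribʳ-* r (suc k) l) ⟩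
    1 + suc l * (k * (suc k ^ r * l ^ r))
      ≤⟨ +-mono-≤ (1≤power (suc r)) (*-monoˡ-≤ (k * (suc k ^ r * l ^ r)) (s≤2l 1≤l)) ⟩
    l ^ suc r + (2 * l) * (k * (suc k ^ r * l ^ r))
      ≡⟨ regroup l k (suc k ^ r) (l ^ r) ⟩
    (1 + 2 * (k * suc k ^ r)) * (l * l ^ r)
      ∎
    where
    open ≤-Reasoning
    r = rank init
    1≤power : ∀ d → 1 ≤ l ^ d
    1≤power d = >-nonZero⁻¹ (l ^ d) {{m^n≢0 l d {{>-nonZero 1≤l}}}}
    s≤2l : ∀ {l} → 1 ≤ l → suc l ≤ 2 * l
    s≤2l {l} 1≤l = begin
      1 + l       ≤⟨ +-monoˡ-≤ l 1≤l ⟩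
      l + l       ≡⟨ cong (l +_) (+-identityʳ l) ⟨
      2 * l       ∎
    level-bound : ∀ {L} → L ≤ l → suc (L * k) ≤ suc k * l
    level-bound {L} L≤l = begin
      1 + L * k   ≤⟨ +-mono-≤ 1≤l (*-monoˡ-≤ k L≤l) ⟩
      l + l * k   ≡⟨ cong (l +_) (*-comm l k) ⟩
      l + k * l   ∎
    regroup : ∀ l k P Q → l * Q + (2 * l) * (k * (P * Q)) ≡ (1 + 2 * (k * P)) * (l * Q)
    regroup = solve-∀

  ¬fork⇒sparse : ¬ Fork → Sparse (F? init)
  -- The threshold 2 makes the logarithm at least 1.
  ¬fork⇒sparse ¬fork = suc (rank init) , 1 + 2 * (k * suc k ^ rank init) , 2 , λ x 2≤x →
    ≤-trans
      (Unique-⊆⇒length-≤ (Unique.filter⁺ (F? init) (Unique.upTo⁺ (suc x))) λ n∈ →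
        let n∈upTo , f = ∈-filter⁻ (F? init) {xs = upTo (suc x)} n∈ in
        ∈-numbersUpTo (s≤s⁻¹ (∈-upTo⁻ n∈upTo)) f)
      (length-numbersUpTo ¬fork (log-bound 2≤x))

-- Pumping

module _ (S : Pred ℕ 0ℓ) where

  -- Unlike `IsSumOfAtMost` this admits the empty sum, so multiples with factor 0 need no exception.
  Sums : ℕ → Pred ℕ 0ℓ
  Sums N n = ∃[ xs ] length xs ≤ N × All S xs × sum xs ≡ n

module _ {S : Pred ℕ 0ℓ} where

  sums-1 : ∀ {s} → S s → Sums S 1 s
  sums-1 {s} s∈S = s ∷ [] , ≤-refl , s∈S ∷ [] , +-identityʳ s

  sums-+ : ∀ {M N m n} → Sums S M m → Sums S N n → Sums S (M + N) (m + n)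
  sums-+ (xs , #xs , xs∈S , refl) (ys , #ys , ys∈S , refl) =
    xs ++ ys , ≤-trans (≤-reflexive (length-++ xs)) (+-mono-≤ #xs #ys) ,
    All.++⁺ xs∈S ys∈S , sum-++ xs ys

  sums-* : ∀ c {N n} → Sums S N n → Sums S (c * N) (c * n)
  sums-* zero    _ = [] , z≤n , [] , refl
  sums-* (suc c) s = sums-+ s (sums-* c s)

  sums-≤ : ∀ {M N n} → M ≤ N → Sums S M n → Sums S N n
  sums-≤ M≤N (xs , #xs , rest) = xs , ≤-trans #xs M≤N , rest

  -- Greedy choice: each of the `R` terms takes as much of `ρ` as fits, at most `B`.
  sums-progression : ∀ {N u D B} → (∀ {t} → t ≤ B → Sums S N (u + D * t)) →
                     ∀ R {ρ} → ρ ≤ R * B → Sums S (R * N) (R * u + D * ρ)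
  sums-progression {D = D} term zero z≤n = [] , z≤n , [] , sym (*-zeroʳ D)
  sums-progression {N} {u} {D} {B} term (suc R) {ρ} ρ≤ =
    subst (Sums S (N + R * N)) total
      (sums-+ (term (m⊓n≤m B ρ)) (sums-progression {N} {u} {D} {B} term R rest))
    where
    open ≤-Reasoning
    rest : ρ ∸ B ≤ R * B
    rest = begin
      ρ ∸ B           ≤⟨ ∸-monoˡ-≤ B ρ≤ ⟩
      B + R * B ∸ B   ≡⟨ m+n∸m≡n B (R * B) ⟩
      R * B           ∎
    regroup : ∀ u D t R v → u + D * t + (R * u + D * v) ≡ u + R * u + D * (t + v)
    regroup = solve-∀
    total : u + D * (B ⊓ ρ) + (R * u + D * (ρ ∸ B)) ≡ u + R * u + D * ρ
    total = trans (regroup u D (B ⊓ ρ) R (ρ ∸ B))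
      (cong (λ x → u + R * u + D * x) (m⊓n+n∸m≡n B ρ))

  sums⇒isSumOfAtMost : ∀ {N n} → 0 < n → Sums S N n → IsSumOfAtMost N S n
  sums⇒isSumOfAtMost 0<n ([]     , _ , _ , refl) = contradiction 0<n λ ()
  sums⇒isSumOfAtMost 0<n (x ∷ xs , rest) = x ∷ xs , s≤s z≤n , rest

-- The numbers whose base-K expansion, down to a leading part z, consists of m
-- digits a and a + r.
data TwoDigit (K a r z : ℕ) : ℕ → ℕ → Set where
  base : TwoDigit K a r z 0 z
  low  : ∀ {m t} → TwoDigit K a r z m t → TwoDigit K a r z (suc m) (a + t * K)
  high : ∀ {m t} → TwoDigit K a r z m t → TwoDigit K a r z (suc m) (a + r + t * K)

-- For an automaton, `c` and `p` are the value and the place value of a word leading to the hub, `a`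
-- and `a + r` are the values of two loops of equal length, `K` is `k` to that length, and `z` is
-- accepted from the hub.
record Pump (S : Pred ℕ 0ℓ) : Set where
  field
    K a r z p c : ℕ
    0<r    : 0 < r
    a+r<K  : a + r < K
    0<z    : 0 < z
    0<p    : 0 < p
    member : ∀ {m t} → TwoDigit K a r z m t → S (c + t * p)

module _ {k : ℕ} (2≤k : 2 ≤ k) {m : ℕ} (system : StateSystem k m) (init : Fin m) where
  open Base k 2≤k
  open StateSystem system
  open Graph 2≤k system
  open Growth 2≤k system init

  -- The two loops may differ in length. Concatenating them in both orders gives words of equal
  -- length, whose values differ because their last digits are `d` and `e`.
  fork⇒pump : Fork → Pump (F init)
  fork⇒pump fork = case <-cmp u v of λ where
      (tri< u<v _ _) → pump uPath vPath u<v
      (tri≈ _ u≡v _) → contradiction u≡v u≢v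
      (tri> _ _ v<u) → pump vPath uPath v<u
    where
    open Fork fork
    j₁ = proj₁ loop-d
    c₁ = proj₁ (proj₂ loop-d)
    j₂ = proj₁ loop-e
    c₂ = proj₁ (proj₂ loop-e)
    x = toℕ d + c₁ * k
    y = toℕ e + c₂ * k
    xPath : Path hub (suc j₁) x hub
    xPath = cons d (proj₂ (proj₂ loop-d))
    yPath : Path hub (suc j₂) y hub
    yPath = cons e (proj₂ (proj₂ loop-e))
    ℓ = suc j₁ + suc j₂
    u = x + y * k ^ suc j₁
    v = y + x * k ^ suc j₂
    uPath : Path hub ℓ u hub
    uPath = xPath ◅◅ yPath
    vPath : Path hub ℓ v hub
    vPath = subst (λ j → Path hub j v hub) (+-comm (suc j₂) (suc j₁)) (yPath ◅◅ xPath)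
    regroup : ∀ d c k y K → d + (c + y * K) * k ≡ d + c * k + y * (k * K)
    regroup = solve-∀
    u≢v : u ≢ v
    u≢v eq = d≢e (proj₁ (digit-unique d e {c₁ + y * k ^ j₁} {c₂ + x * k ^ j₂}
      (trans (regroup (toℕ d) c₁ k y (k ^ j₁))
        (trans eq (sym (regroup (toℕ e) c₂ k x (k ^ j₂)))))))
    z = proj₁ exit
    0<z : 0 < z
    0<z = n≢0⇒n>0 (proj₁ (proj₂ exit))
    pump : ∀ {a b} → Path hub ℓ a hub → Path hub ℓ b hub → a < b → Pump (F init)
    pump {a} {b} aPath bPath a<b = record
      { K = k ^ ℓ ; a = a ; r = b ∸ a ; z = z
      ; p = k ^ proj₁ accessible ; c = proj₁ (proj₂ accessible)
      ; 0<r    = m<n⇒0<n∸m a<b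
      ; a+r<K  = subst (_< k ^ ℓ) (sym a+r≡b) (path< bPath)
      ; 0<z    = 0<z
      ; 0<p    = >-nonZero⁻¹ _ {{m^n≢0 k (proj₁ accessible)}}
      ; member = λ w → let 0<t , f = at-hub w in path-up (proj₂ (proj₂ accessible)) 0<t f
      }
      where
      a+r≡b : a + (b ∸ a) ≡ b
      a+r≡b = m+[n∸m]≡n (<⇒≤ a<b)
      positive : ∀ {c t} → 0 < t → 0 < c + t * k ^ ℓ
      positive {c} {t} 0<t = <-≤-trans (m<n⇒m<n*o (k ^ ℓ) {{m^n≢0 k ℓ}} 0<t) (m≤n+m (t * k ^ ℓ) c)
      at-hub : ∀ {m t} → TwoDigit (k ^ ℓ) a (b ∸ a) z m t → 0 < t × F hub t
      at-hub base     = 0<z , proj₂ (proj₂ exit)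
      at-hub (low w)  = let 0<t , f = at-hub w in positive 0<t , path-up aPath 0<t f
      at-hub (high {t = t} w) = let 0<t , f = at-hub w in positive 0<t ,
        subst (λ b → F hub (b + t * k ^ ℓ)) (sym a+r≡b) (path-up bPath 0<t f)

-- Exponentially many elements from a pump

module PumpProperties {S : Pred ℕ 0ℓ} (pump : Pump S) where
  open Pump pump

  -- This is `K - 1`, written so that `κ` is visibly at least `r`.
  κ = a + r + (K ∸ suc (a + r))

  K≡1+κ : K ≡ suc κ
  K≡1+κ = sym (m+[n∸m]≡n a+r<K)

  0<κ : 0 < κ
  0<κ = ≤-trans 0<r (≤-trans (m≤n+m r a) (m≤m+n (a + r) _))

  2≤K : 2 ≤ K
  2≤K = subst (2 ≤_) (sym K≡1+κ) (s≤s 0<κ)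

  instance
    K≢0 : NonZero K
    K≢0 = >-nonZero (≤-trans (s≤s z≤n) 2≤K)

    p≢0 : NonZero p
    p≢0 = >-nonZero 0<p

  Pumped : ℕ → ℕ → Set
  Pumped = TwoDigit K a r z

  σ : ℕ → ℕ
  σ zero    = z
  σ (suc m) = a + σ m * K

  σ-level : ∀ m → Pumped m (σ m)
  σ-level zero    = base
  σ-level (suc m) = low (σ-level m)

  K^m≤σ : ∀ m → K ^ m ≤ σ m
  K^m≤σ zero    = 0<z
  K^m≤σ (suc m) = begin
    K * K ^ m   ≡⟨ *-comm K (K ^ m) ⟩
    K ^ m * K   ≤⟨ *-monoˡ-≤ K (K^m≤σ m) ⟩
    σ m * K     ≤⟨ m≤n+m (σ m * K) a ⟩
    a + σ m * K ∎
    where open ≤-Reasoning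

  digit-bound : ∀ {e t m} → e < K → t < suc z * K ^ m → e + t * K < suc z * K ^ suc m
  digit-bound {e} {t} {m} e<K t< = begin-strict
    e + t * K               <⟨ +-monoˡ-< (t * K) e<K ⟩
    suc t * K               ≤⟨ *-monoˡ-≤ K t< ⟩
    suc z * K ^ m * K       ≡⟨ *-assoc (suc z) (K ^ m) K ⟩
    suc z * (K ^ m * K)     ≡⟨ cong (suc z *_) (*-comm (K ^ m) K) ⟩
    suc z * (K * K ^ m)     ∎
    where open ≤-Reasoning

  level-bound : ∀ {m t} → Pumped m t → t < suc z * K ^ m
  level-bound base = ≤-reflexive (sym (*-identityʳ (suc z)))
  level-bound (low {m} w)  = digit-bound {m = m} (≤-<-trans (m≤m+n a r) a+r<K) (level-bound w)
  level-bound (high {m} w) = digit-bound {m = m} a+r<K (level-bound w)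

  -- Chosen so that the elements obtained from `m` digits are at most `C * K ^ m`.
  C : ℕ
  C = c + suc z * p

  0<C : 0 < C
  0<C = ≤-trans 0<p (≤-trans (m≤m+n p (z * p)) (m≤n+m (suc z * p) c))

  member-bound : ∀ {m t} → Pumped m t → c + t * p ≤ C * K ^ m
  member-bound {m} {t} w = begin
    c + t * p                           ≤⟨ +-mono-≤ (m≤m*n c (K ^ m) {{m^n≢0 K m}})
                                             (*-monoˡ-≤ p (<⇒≤ (level-bound w))) ⟩
    c * K ^ m + suc z * K ^ m * p       ≡⟨ regroup c (K ^ m) (suc z) p ⟩
    (c + suc z * p) * K ^ m             ∎
    where
    open ≤-Reasoning
    regroup : ∀ c P z p → c * P + z * P * p ≡ (c + z * p) * P
    regroup = solve-∀

  residue-K : ∀ {e e′ t t′} → e < K → e′ < K → e + t * K ≡ e′ + t′ * K → e ≡ e′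
  residue-K {e} {e′} {t} {t′} e<K e′<K eq = begin
    e                  ≡⟨ m<n⇒m%n≡m e<K ⟨
    e % K              ≡⟨ [m+kn]%n≡m%n e t K ⟨
    (e + t * K) % K    ≡⟨ cong (_% K) eq ⟩
    (e′ + t′ * K) % K  ≡⟨ [m+kn]%n≡m%n e′ t′ K ⟩
    e′ % K             ≡⟨ m<n⇒m%n≡m e′<K ⟩
    e′                 ∎
    where open ≡-Reasoning

  affine-injective : ∀ e q .{{_ : NonZero q}} {s t} → e + s * q ≡ e + t * q → s ≡ t
  affine-injective e q {s} {t} eq = *-cancelʳ-≡ s t q (+-cancelˡ-≡ e _ _ eq)

  elements : ℕ → List ℕ
  elements zero    = z ∷ []
  elements (suc m) = map (λ t → a + t * K) (elements m) ++ map (λ t → a + r + t * K) (elements m)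

  elements-level : ∀ m → All (Pumped m) (elements m)
  elements-level zero    = base ∷ []
  elements-level (suc m) = All.++⁺ (All.map⁺ (All.map low (elements-level m)))
                                   (All.map⁺ (All.map high (elements-level m)))

  -- The last digits `a` and `a + r` are different residues modulo `K`, so the two halves of the
  -- list are disjoint.
  elements-unique : ∀ m → Unique (elements m)
  elements-unique zero    = [] ∷ []
  elements-unique (suc m) = Unique.++⁺
    (Unique.map⁺ (affine-injective a K) (elements-unique m))
    (Unique.map⁺ (affine-injective (a + r) K) (elements-unique m))
    λ (v∈low , v∈high) →
      let s , _ , v≡ = ∈-map⁻ (λ t → a + t * K) v∈low
          t , _ , v≡′ = ∈-map⁻ (λ t → a + r + t * K) v∈high
      in <⇒≢ (m<m+n a 0<r)
           (residue-K {t = s} {t′ = t} (≤-<-trans (m≤m+n a r) a+r<K) a+r<K (trans (sym v≡) v≡′))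

  length-elements : ∀ m → length (elements m) ≡ 2 ^ m
  length-elements zero    = refl
  length-elements (suc m) = begin
    length (map f es ++ map g es)                ≡⟨ length-++ (map f es) ⟩
    length (map f es) + length (map g es)        ≡⟨ cong₂ _+_ (length-map f es) (length-map g es) ⟩
    length es + length es                        ≡⟨ cong (λ l → l + l) (length-elements m) ⟩
    2 ^ m + 2 ^ m                                ≡⟨ cong (2 ^ m +_) (+-identityʳ (2 ^ m)) ⟨
    2 * 2 ^ m                                    ∎
    where
    open ≡-Reasoning
    es = elements m
    f g : ℕ → ℕ
    f t = a + t * K
    g t = a + r + t * K

  module _ (S? : Decidable S) where

    2^m≤π : ∀ m → 2 ^ m ≤ π S? (C * K ^ m)
    2^m≤π m = begin
      2 ^ m                                   ≡⟨ length-elements m ⟨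
      length (elements m)                     ≡⟨ length-map (λ t → c + t * p) (elements m) ⟨
      length (map (λ t → c + t * p) (elements m))
        ≤⟨ Unique-⊆⇒length-≤ (Unique.map⁺ (affine-injective c p) (elements-unique m)) included ⟩
      π S? (C * K ^ m)                        ∎
      where
      open ≤-Reasoning
      included : ∀ {x} → x List.∈ map (λ t → c + t * p) (elements m) →
                 x List.∈ filter S? (upTo (suc (C * K ^ m)))
      included x∈ with ∈-map⁻ (λ t → c + t * p) x∈
      ... | t , t∈ , refl = ∈-filter⁺ S? (∈-upTo⁺ (s≤s (member-bound w))) (member w)
        where
        w : Pumped m t
        w = All.lookup (elements-level m) t∈

    log-bound : ∀ {m} → 1 ≤ m → ⌊log₂ (C * K ^ m) ⌋ ≤ (C + K) * m
    log-bound {m} 1≤m = begin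
      ⌊log₂ (C * K ^ m) ⌋                ≤⟨ ⌊log₂⌋-mono-≤ (*-mono-≤ (<⇒≤ (n<k^n ≤-refl C))
                                              (^-monoˡ-≤ m (<⇒≤ (n<k^n ≤-refl K)))) ⟩
      ⌊log₂ (2 ^ C * (2 ^ K) ^ m) ⌋      ≡⟨ cong (λ x → ⌊log₂ (2 ^ C * x) ⌋) (^-*-assoc 2 K m) ⟩
      ⌊log₂ (2 ^ C * 2 ^ (K * m)) ⌋      ≡⟨ cong ⌊log₂_⌋ (^-distribˡ-+-* 2 C (K * m)) ⟨
      ⌊log₂ (2 ^ (C + K * m)) ⌋          ≡⟨ ⌊log₂[2^n]⌋≡n (C + K * m) ⟩
      C + K * m                          ≤⟨ +-monoˡ-≤ (K * m) (m≤m*n C m {{>-nonZero 1≤m}}) ⟩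
      C * m + K * m                      ≡⟨ *-distribʳ-+ m C K ⟨
      (C + K) * m                        ∎
      where open ≤-Reasoning

    -- Up to `C * K ^ m` there are at least `2 ^ m` elements, while the logarithm of that number is
    -- linear in `m`. Sparseness would bound `2 ^ m` by a polynomial in `m`.
    pump⇒¬sparse : ¬ Sparse S?
    pump⇒¬sparse (d , B , x₀ , bound) with exponential-dominates (B * (C + K) ^ d) d x₀
    ... | m , x₀≤m , 1≤m , small = <⇒≱ small (begin
      2 ^ m                          ≤⟨ 2^m≤π m ⟩
      π S? (C * K ^ m)               ≤⟨ bound (C * K ^ m) x₀≤x ⟩
      B * ⌊log₂ (C * K ^ m) ⌋ ^ d    ≤⟨ *-monoʳ-≤ B (^-monoˡ-≤ d (log-bound 1≤m)) ⟩
      B * ((C + K) * m) ^ d          ≡⟨ cong (B *_) (^-distribʳ-* d (C + K) m) ⟩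
      B * ((C + K) ^ d * m ^ d)      ≡⟨ *-assoc B ((C + K) ^ d) (m ^ d) ⟨
      B * (C + K) ^ d * m ^ d        ∎)
      where
      open ≤-Reasoning
      x₀≤x : x₀ ≤ C * K ^ m
      x₀≤x = begin
        x₀         ≤⟨ x₀≤m ⟩
        m          ≤⟨ <⇒≤ (n<k^n 2≤K m) ⟩
        K ^ m      ≤⟨ m≤n*m (K ^ m) C {{>-nonZero 0<C}} ⟩
        C * K ^ m  ∎

-- An additive basis from a pump

module Basis {S : Pred ℕ 0ℓ} (pump : Pump S) where
  open Pump pump
  open PumpProperties pump

  -- Turning a low digit at position `i` into a high one adds `D * K ^ i` to the element.
  D : ℕ
  D = r * p

  0<D : 0 < D
  0<D = *-mono-≤ 0<r 0<p

  smallest : ℕ → ℕ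
  smallest m = c + σ m * p

  -- The first `h` numbers receive the high last digit and the others the low one; the sum depends
  -- only on how many are high.
  lift : ∀ {m es} → All (Pumped m) es → ∀ h → h ≤ length es → ∃[ es′ ]
         All (Pumped (suc m)) es′ × length es′ ≡ length es ×
         sum es′ ≡ length es * a + r * h + sum es * K
  lift [] zero z≤n = [] , [] , refl , sym (trans (+-identityʳ (r * 0)) (*-zeroʳ r))
  lift {es = e ∷ es} (w ∷ ws) zero z≤n with lift ws zero z≤n
  ... | es′ , ws′ , len , total = a + e * K ∷ es′ , low w ∷ ws′ , cong suc len ,
        trans (cong (a + e * K +_) total) (regroup a e K (length es) r (sum es))
    where
    regroup : ∀ a e K l r s → a + e * K + (l * a + r * 0 + s * K) ≡ a + l * a + r * 0 + (e + s) * K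
    regroup = solve-∀
  lift {es = e ∷ es} (w ∷ ws) (suc h) (s≤s h≤) with lift ws h h≤
  ... | es′ , ws′ , len , total = a + r + e * K ∷ es′ , high w ∷ ws′ , cong suc len ,
        trans (cong (a + r + e * K +_) total) (regroup a r e K (length es) h (sum es))
    where
    regroup : ∀ a r e K l h s →
      a + r + e * K + (l * a + r * h + s * K) ≡ a + l * a + r * (1 + h) + (e + s) * K
    regroup = solve-∀

  -- With κ = K - 1 summands, the number of high digits at each position can be
  -- any base-K digit of t.
  spectrum : ∀ m t → t < K ^ m → ∃[ es ]
             All (Pumped m) es × length es ≡ κ × sum es ≡ κ * σ m + r * t
  spectrum zero t t<1 = replicate κ z , All.replicate⁺ κ base , length-replicate κ ,
    trans (sum-replicate κ) (sym (trans (cong (λ t → κ * z + r * t) (n<1⇒n≡0 t<1))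
      (trans (cong (κ * z +_) (*-zeroʳ r)) (+-identityʳ (κ * z)))))
    where
    sum-replicate : ∀ n → sum (replicate n z) ≡ n * z
    sum-replicate zero    = refl
    sum-replicate (suc n) = cong (z +_) (sum-replicate n)
  spectrum (suc m) t t< with spectrum m (t / K) (m<n*o⇒m/o<n (subst (t <_) (*-comm K (K ^ m)) t<))
  ... | es , ws , len , total
    with lift ws (t % K) (subst (t % K ≤_) (sym len) (s≤s⁻¹ (subst (t % K <_) K≡1+κ (m%n<n t K))))
  ...   | es′ , ws′ , len′ , total′ = es′ , ws′ , trans len′ len , (begin
    sum es′                                                        ≡⟨ total′ ⟩
    length es * a + r * (t % K) + sum es * K
      ≡⟨ cong₂ (λ l s → l * a + r * (t % K) + s * K) len total ⟩
    κ * a + r * (t % K) + (κ * σ m + r * (t / K)) * K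
      ≡⟨ regroup κ a r (t % K) (σ m) (t / K) K ⟩
    κ * (a + σ m * K) + r * (t % K + t / K * K)
      ≡⟨ cong (λ t → κ * (a + σ m * K) + r * t) (m≡m%n+[m/n]*n t K) ⟨
    κ * (a + σ m * K) + r * t                                      ∎)
    where
    open ≡-Reasoning
    regroup : ∀ κ a r t₀ s t₁ K →
      κ * a + r * t₀ + (κ * s + r * t₁) * K ≡ κ * (a + s * K) + r * (t₀ + t₁ * K)
    regroup = solve-∀

  block : ∀ m {t} → t < K ^ m → Sums S κ (κ * smallest m + D * t)
  block m {t} t< with spectrum m t t<
  ... | es , ws , len , total = map (λ t → c + t * p) es ,
    ≤-reflexive (trans (length-map (λ t → c + t * p) es) len) ,
    All.map⁺ (All.map member ws) , (begin
      sum (map (λ t → c + t * p) es)     ≡⟨ sum-affine es ⟩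
      length es * c + sum es * p         ≡⟨ cong₂ (λ l s → l * c + s * p) len total ⟩
      κ * c + (κ * σ m + r * t) * p      ≡⟨ regroup κ c (σ m) r t p ⟩
      κ * (c + σ m * p) + r * p * t      ∎)
    where
    open ≡-Reasoning
    regroup : ∀ κ c s r t p → κ * c + (κ * s + r * t) * p ≡ κ * (c + s * p) + r * p * t
    regroup = solve-∀
    regroup-∷ : ∀ c e p l s → c + e * p + (l * c + s * p) ≡ c + l * c + (e + s) * p
    regroup-∷ = solve-∀
    sum-affine : ∀ es → sum (map (λ t → c + t * p) es) ≡ length es * c + sum es * p
    sum-affine []       = refl
    sum-affine (e ∷ es) = trans (cong (c + e * p +_) (sum-affine es))
                                (regroup-∷ c e p (length es) (sum es))

  K^m≤smallest : ∀ m → K ^ m ≤ smallest m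
  K^m≤smallest m = begin
    K ^ m       ≤⟨ K^m≤σ m ⟩
    σ m         ≤⟨ m≤m*n (σ m) p ⟩
    σ m * p     ≤⟨ m≤n+m (σ m * p) c ⟩
    c + σ m * p ∎
    where open ≤-Reasoning

  smallest≤CK^m : ∀ m → smallest m ≤ C * K ^ m
  smallest≤CK^m m = member-bound (σ-level m)

  -- A block has `K ^ m` terms, and stretches of `smallest m` terms must be filled; since
  -- `smallest m ≤ C * K ^ m`, about `Q = 2 * C` blocks do. Taking `D * Q` blocks makes their offset
  -- `D * (G * smallest m)` a multiple of `D`. As `G * smallest (suc m) ≤ H * smallest m`, at most
  -- `D * H` further summands `smallest m` lead to the next length.
  Q G H N₀ : ℕ
  Q  = 2 * C
  G  = Q * κ
  H  = G * (C * K)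
  N₀ = D * Q * κ + D * H

  block-multiple : ∀ m {ρ} → 1 ≤ m → ρ < smallest m →
                   Sums S (D * Q * κ) (D * Q * (κ * smallest m) + D * ρ)
  block-multiple m {ρ} 1≤m ρ< =
    sums-progression {u = κ * smallest m} {D} {pred (K ^ m)}
      (λ t≤ → block m (≤-trans (s≤s t≤) (≤-reflexive (suc-pred (K ^ m) {{K^m≢0}})))) (D * Q) (begin
        ρ                                   ≤⟨ <⇒≤ ρ< ⟩
        smallest m                          ≤⟨ smallest≤CK^m m ⟩
        C * K ^ m                           ≡⟨ cong (C *_) (suc-pred (K ^ m) {{K^m≢0}}) ⟨
        C * suc (pred (K ^ m))              ≤⟨ *-monoʳ-≤ C (+-monoˡ-≤ (pred (K ^ m)) 1≤pred) ⟩
        C * (pred (K ^ m) + pred (K ^ m))   ≡⟨ regroup C (pred (K ^ m)) ⟩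
        1 * Q * pred (K ^ m)                ≤⟨ *-monoˡ-≤ (pred (K ^ m)) (*-monoˡ-≤ Q 0<D) ⟩
        D * Q * pred (K ^ m)                ∎)
    where
    open ≤-Reasoning
    regroup : ∀ C B → C * (B + B) ≡ 1 * (2 * C) * B
    regroup = solve-∀
    K^m≢0 : NonZero (K ^ m)
    K^m≢0 = m^n≢0 K m
    -- This is where `1 ≤ m` enters: it gives `K ^ m ≤ 2 * pred (K ^ m)`, whence the factor 2 in
    -- `Q`.
    1≤pred : 1 ≤ pred (K ^ m)
    1≤pred = pred-mono-≤ (begin
      2     ≤⟨ 2≤K ⟩
      K     ≡⟨ *-identityʳ K ⟨
      K ^ 1 ≤⟨ ^-monoʳ-≤ K 1≤m ⟩
      K ^ m ∎)

  -- Divide `y ∸ G * s` by `s = smallest m`. The blocks account for the remainder and `D * h` copies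
  -- of the element `s` for the quotient `h`; the bound `H` on `h` does not depend on `m`.
  multiples-at-level : ∀ m {y} → 1 ≤ m → G * smallest m ≤ y → y < G * smallest (suc m) →
                       Sums S N₀ (D * y)
  multiples-at-level m {y} 1≤m lo hi =
    sums-≤ (+-monoʳ-≤ (D * Q * κ) (≤-trans (≤-reflexive (*-identityʳ (D * h))) (*-monoʳ-≤ D h≤H)))
      (subst (Sums S _) total
        (sums-+ (block-multiple m 1≤m (m%n<n w s)) (sums-* (D * h) (sums-1 (member (σ-level m))))))
    where
    open ≤-Reasoning
    s = smallest m
    instance
      s≢0 : NonZero s
      s≢0 = >-nonZero (≤-trans (>-nonZero⁻¹ (K ^ m) {{m^n≢0 K m}}) (K^m≤smallest m))
    w = y ∸ G * s
    h = w / s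
    h≤H : h ≤ H
    h≤H = *-cancelʳ-≤ h H s (begin
      h * s                        ≤⟨ m/n*n≤m w s ⟩
      w                            ≤⟨ m∸n≤m y (G * s) ⟩
      y                            ≤⟨ <⇒≤ hi ⟩
      G * smallest (suc m)         ≤⟨ *-monoʳ-≤ G (smallest≤CK^m (suc m)) ⟩
      G * (C * (K * K ^ m))        ≤⟨ *-monoʳ-≤ G (*-monoʳ-≤ C (*-monoʳ-≤ K (K^m≤smallest m))) ⟩
      G * (C * (K * s))            ≡⟨ regroup-H G C K s ⟩
      G * (C * K) * s              ∎)
      where
      regroup-H : ∀ G C K s → G * (C * (K * s)) ≡ G * (C * K) * s
      regroup-H = solve-∀
    regroup : ∀ D Q κ s ρ h → D * Q * (κ * s) + D * ρ + D * h * s ≡ D * (Q * κ * s + (ρ + h * s))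
    regroup = solve-∀
    total : D * Q * (κ * s) + D * (w % s) + D * h * s ≡ D * y
    total = trans (regroup D Q κ s (w % s) h)
      (cong (D *_) (trans (cong (G * s +_) (sym (m≡m%n+[m/n]*n w s))) (m+[n∸m]≡n lo)))

  y₀ : ℕ
  y₀ = G * smallest 1

  large-multiples : ∀ {y} → y₀ ≤ y → Sums S N₀ (D * y)
  large-multiples {y} y₀≤y =
    -- The index is shifted because length 0 is excluded.
    let m , lo , hi = bracket (λ m → G * smallest (suc m)) y₀≤y y unbounded
    in multiples-at-level (suc m) (s≤s z≤n) lo hi
    where
    open ≤-Reasoning
    G≢0 : NonZero G
    G≢0 = >-nonZero (*-mono-≤ (≤-trans 0<C (m≤m+n C _)) 0<κ)
    unbounded : y < G * smallest (suc y)
    unbounded = begin-strict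
      y                    <⟨ n<1+n y ⟩
      suc y                <⟨ n<k^n 2≤K (suc y) ⟩
      K ^ suc y            ≤⟨ K^m≤smallest (suc y) ⟩
      smallest (suc y)     ≤⟨ m≤n*m (smallest (suc y)) G {{G≢0}} ⟩
      G * smallest (suc y) ∎

  instance
    D≢0 : NonZero D
    D≢0 = >-nonZero 0<D

  -- Taking `n % D` copies of the sum congruent to 1 leaves a multiple of `D`, large enough for
  -- `large-multiples` by the choice of the threshold. The successor in the threshold keeps `n`
  -- positive, so that the sum is not empty.
  representsAll : ∀ {E w} → Sums S E (1 + D * w) →
                  RepresentsAllFrom S (N₀ + D * E) (suc ((D * w + y₀) * D))
  representsAll {E} {w} e n M≤n = sums⇒isSumOfAtMost (≤-trans (s≤s z≤n) M≤n)
    (sums-≤ (+-monoʳ-≤ N₀ (*-monoˡ-≤ E (<⇒≤ (m%n<n n D))))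
      (subst (Sums S _) total
        (sums-+ (large-multiples {q ∸ i * w} large) (sums-* i e))))
    where
    open ≤-Reasoning
    i = n % D
    q = n / D
    bound : D * w + y₀ ≤ q
    bound = begin
      D * w + y₀             ≡⟨ m*n/n≡m (D * w + y₀) D ⟨
      (D * w + y₀) * D / D   ≤⟨ /-monoˡ-≤ D (≤-trans (n≤1+n _) M≤n) ⟩
      n / D                  ∎
    iw≤Dw : i * w ≤ D * w
    iw≤Dw = *-monoˡ-≤ w (<⇒≤ (m%n<n n D))
    large : y₀ ≤ q ∸ i * w
    large = begin
      y₀                    ≡⟨ m+n∸m≡n (i * w) y₀ ⟨
      i * w + y₀ ∸ i * w    ≤⟨ ∸-monoˡ-≤ (i * w) (≤-trans (+-monoˡ-≤ y₀ iw≤Dw) bound) ⟩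
      q ∸ i * w             ∎
    regroup : ∀ D y i w → D * y + i * (1 + D * w) ≡ i + (y + i * w) * D
    regroup = solve-∀
    total : D * (q ∸ i * w) + i * (1 + D * w) ≡ n
    total = trans (regroup D (q ∸ i * w) i w)
      (trans (cong (λ q → i + q * D)
               (m∸n+n≡m (≤-trans iw≤Dw (≤-trans (m≤m+n (D * w) y₀) bound))))
             (sym (m≡m%n+[m/n]*n n D)))

-- The algorithm

-- Modulo D, a difference is a sum, so Bézout's identity yields a sum of elements
-- of S congruent to the gcd.
module _ {S : Pred ℕ 0ℓ} (D : ℕ) .{{_ : NonZero D}} where

  Represented : ℕ → Set
  Represented g = ∃₂ λ E w → Sums S E (g + D * w)

  represented-gcd : ∀ {g s} → Represented g → S s → Represented (gcd g s)
  represented-gcd {g} {s} (E , w , e) s∈S with Bézout.identity (gcd-GCD g s)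
  ... | Bézout.+- x y eq = _ , x * w + y * s ,
    subst (Sums S _) total (sums-+ (sums-* x e) (sums-* (pred D * y) (sums-1 s∈S)))
    where
    open ≡-Reasoning
    regroup₁ : ∀ x g d w y s →
      x * (g + suc d * w) + d * y * s ≡ x * g + (suc d * (x * w) + d * (y * s))
    regroup₁ = solve-∀
    regroup₂ : ∀ h y s d X → h + y * s + (suc d * X + d * (y * s)) ≡ h + suc d * (X + y * s)
    regroup₂ = solve-∀
    total : x * (g + D * w) + pred D * y * s ≡ gcd g s + D * (x * w + y * s)
    total = subst (λ D′ → x * (g + D′ * w) + pred D * y * s ≡ gcd g s + D′ * (x * w + y * s)) (suc-pred D) (begin
      x * (g + suc (pred D) * w) + pred D * y * s
        ≡⟨ regroup₁ x g (pred D) w y s ⟩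
      x * g + (suc (pred D) * (x * w) + pred D * (y * s))
        ≡⟨ cong (_+ (suc (pred D) * (x * w) + pred D * (y * s))) eq ⟨
      gcd g s + y * s + (suc (pred D) * (x * w) + pred D * (y * s))
        ≡⟨ regroup₂ (gcd g s) y s (pred D) (x * w) ⟩
      gcd g s + suc (pred D) * (x * w + y * s) ∎)
  ... | Bézout.-+ x y eq = _ , x * g + pred D * x * w ,
    subst (Sums S _) total (sums-+ (sums-* y (sums-1 s∈S)) (sums-* (pred D * x) e))
    where
    open ≡-Reasoning
    regroup : ∀ h x g d w →
      h + x * g + d * x * (g + suc d * w) ≡ h + suc d * (x * g + d * x * w)
    regroup = solve-∀
    total : y * s + pred D * x * (g + D * w) ≡ gcd g s + D * (x * g + pred D * x * w)
    total = subst (λ D′ → y * s + pred D * x * (g + D′ * w) ≡ gcd g s + D′ * (x * g + pred D * x * w)) (suc-pred D) (begin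
      y * s + pred D * x * (g + suc (pred D) * w)
        ≡⟨ cong (_+ pred D * x * (g + suc (pred D) * w)) eq ⟨
      gcd g s + x * g + pred D * x * (g + suc (pred D) * w)
        ≡⟨ regroup (gcd g s) x g (pred D) w ⟩
      gcd g s + suc (pred D) * (x * g + pred D * x * w) ∎)

  module _ (outside? : ∀ g .{{_ : NonZero g}} → Dec (∃[ s ] S s × ¬ g ∣ s)) where

    -- Invariant: `g` is a sum modulo `D`, and every common divisor of `S` divides `g`. An element
    -- that `g` does not divide replaces `g` by a smaller gcd; if there is none, `g` is the gcd of
    -- `S`.
    gcd-descent : ∀ g → 0 < g → Represented g → (∀ d → (∀ s → S s → d ∣ s) → d ∣ g) →
                  IsGCD S 1 × Represented 1 ⊎ ¬ IsGCD S 1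
    gcd-descent = <-rec _ λ g rec 0<g rep common → case outside? g {{>-nonZero 0<g}} of λ where
      (yes (s , s∈S , g∤s)) →
        let 0<gcd = n≢0⇒n>0 (gcd[m,n]≢0 g s (inj₁ (λ g≡0 → <⇒≢ 0<g (sym g≡0)))) in
        rec (≤∧≢⇒< (∣⇒≤ {{>-nonZero 0<g}} (gcd[m,n]∣m g s))
              λ eq → g∤s (subst (_∣ s) eq (gcd[m,n]∣n g s)))
            0<gcd (represented-gcd rep s∈S)
            λ d d∣S → gcd-greatest (common d d∣S) (d∣S s s∈S)
      (no none) → let g∣S = λ s s∈S → decidable-stable (g ∣? s) λ g∤s → none (s , s∈S , g∤s) in
        case g ≟ 1 of λ where
          (yes refl) → inj₁ (((λ s _ → 1∣ s) , common) , rep)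
          (no  g≢1)  → inj₂ λ (_ , greatest) → g≢1 (∣1⇒≡1 (greatest g g∣S))

-- Search for the least constants

least : ∀ {P : Pred ℕ 0ℓ} → Decidable P → ∀ n → P n → ∃ (IsLeast P)
least P? = <-rec _ λ n rec pn → case anyUpTo? P? n of λ where
  (yes (m , m<n , pm)) → rec m<n pm
  (no  none)           → n , pn , λ m pm → ≮⇒≥ λ m<n → none (m , m<n , pm)

-- From a known threshold it suffices to step down while the next number is a member; the first
-- non-member rules out all smaller thresholds.
least-threshold : ∀ {X : Pred ℕ 0ℓ} → Decidable X → ∀ M → (∀ n → M ≤ n → X n) →
                  ∃ (IsLeast (λ M → ∀ n → M ≤ n → X n))
least-threshold X? zero    all = 0 , all , λ _ _ → z≤n
least-threshold {X} X? (suc M) all with X? M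
... | no ¬x = suc M , all , λ M′ all′ → ≰⇒> λ M′≤M → ¬x (all′ M M′≤M)
... | yes x = least-threshold X? M λ n M≤n → case m≤n⇒m<n∨m≡n M≤n of λ where
  (inj₁ M<n)  → all n M<n
  (inj₂ refl) → x

module _ {S : Pred ℕ 0ℓ} where

  -- One summand is split off. The alternative `b ≡ 0` stands for an empty remainder, which
  -- `IsSumOfAtMost` excludes.
  isSum-suc⁺ : ∀ {N} n → (S ⊕ (λ b → b ≡ 0 ⊎ IsSumOfAtMost N S b)) n → IsSumOfAtMost (suc N) S n
  isSum-suc⁺ n (a , _ , a∈S , inj₁ refl , total) =
    a ∷ [] , s≤s z≤n , s≤s z≤n , a∈S ∷ [] , total
  isSum-suc⁺ n (a , _ , a∈S , inj₂ (xs , _ , #xs , xs∈S , refl) , total) =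
    a ∷ xs , s≤s z≤n , s≤s #xs , a∈S ∷ xs∈S , total

  isSum-suc⁻ : ∀ {N} n → IsSumOfAtMost (suc N) S n → (S ⊕ (λ b → b ≡ 0 ⊎ IsSumOfAtMost N S b)) n
  isSum-suc⁻ n (a ∷ [] , _ , _ , a∈S ∷ _ , total) = a , 0 , a∈S , inj₁ refl , total
  isSum-suc⁻ n (a ∷ xs@(_ ∷ _) , _ , s≤s #xs , a∈S ∷ xs∈S , total) =
    a , sum xs , a∈S , inj₂ (xs , s≤s z≤n , #xs , xs∈S , refl) , total

module Main {k : ℕ} (2≤k : 2 ≤ k) (A : DFA k) where
  open Base k 2≤k
  open FromDFA 2≤k A
  open Graph 2≤k system
  open Growth 2≤k system (DFA.start A)

  S : Pred ℕ 0ℓ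
  S = AcceptedFrom (DFA.start A)

  S? : Decidable S
  S? = StateSystem.F? system (DFA.start A)

  automatic-S : Automatic S
  automatic-S = automatic-F (DFA.start A)

  automatic-sums : ∀ N → Automatic (IsSumOfAtMost N S)
  -- There are no such sums; the empty set is obtained as an intersection of complementary sets.
  automatic-sums zero    = automatic-⇔
    (λ n (n≡0 , n≢0) → contradiction n≡0 n≢0)
    (λ { n ([] , () , _) ; n (_ ∷ _ , _ , () , _) })
    (automatic-× automatic-≡0 (automatic-¬ automatic-≡0))
  automatic-sums (suc N) = automatic-⇔ isSum-suc⁺ isSum-suc⁻
    (automatic-⊕ automatic-S (automatic-⊎ automatic-≡0 (automatic-sums N)))

  outside? : ∀ g .{{_ : NonZero g}} → Dec (∃[ s ] S s × ¬ g ∣ s)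
  outside? g = inhabited? (automatic-× automatic-S (automatic-¬ (automatic-∣ g)))

  -- The given constants only guarantee that the search ends: cofiniteness is decidable for each
  -- number of summands, so the least one can be found, and then its threshold.
  optimal : ∀ {N M} → RepresentsAllFrom S N M → Conditions S? → Σ (Maybe (ℕ × ℕ)) (IsCorrectOutput S?)
  optimal {N} {M} all conditions with least (λ N → cofinite? (automatic-sums N)) N (M , all)
  ... | N′ , (M′ , all′) , N′-least
    with least-threshold (Automatic.X? (automatic-sums N′)) M′ all′
  ...   | M″ , M″-least =
    just (N′ , M″) , conditions , ((M′ , all′) , N′-least) , M″-least

  solve : Σ (Maybe (ℕ × ℕ)) (IsCorrectOutput S?)
  solve with fork?
  ... | no ¬fork = nothing , λ (¬sparse , _) → ¬sparse (¬fork⇒sparse ¬fork)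
  ... | yes fork = case descent of λ where
      (inj₁ (isGCD , E , w , e)) → optimal (representsAll {E} {w} e) (pump⇒¬sparse S? , isGCD)
      (inj₂ ¬isGCD)              → nothing , λ (_ , isGCD) → ¬isGCD isGCD
    where
    pump : Pump S
    pump = fork⇒pump 2≤k system (DFA.start A) fork
    open Pump pump
    open PumpProperties pump hiding (log-bound)
    open Basis pump
    s₀ = smallest 0
    descent : IsGCD S 1 × Represented {S} D 1 ⊎ ¬ IsGCD S 1
    -- The descent starts from a positive element of `S`, which is a sum with one summand.
    descent = gcd-descent D outside? s₀ (K^m≤smallest 0)
      (1 , 0 , subst (Sums S 1) (sym (trans (cong (s₀ +_) (*-zeroʳ D)) (+-identityʳ s₀)))
                 (sums-1 (member base)))
      λ d d∣S → d∣S s₀ (member base)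

-- Transfer to an equivalent predicate

module _ {S T : Pred ℕ 0ℓ} (S≐T : S ≐ T) where

  isSum-resp : ∀ {N n} → IsSumOfAtMost N S n → IsSumOfAtMost N T n
  isSum-resp (xs , 1≤ , ≤N , xs∈S , total) = xs , 1≤ , ≤N , All.map (proj₁ S≐T) xs∈S , total

  isGCD-resp : ∀ {g} → IsGCD S g → IsGCD T g
  isGCD-resp (common , greatest) =
    (λ s s∈T → common s (proj₂ S≐T s∈T)) ,
    (λ d d∣T → greatest d (λ s s∈S → d∣T s (proj₁ S≐T s∈S)))

  sparse-resp : (S? : Decidable S) (T? : Decidable T) → Sparse S? → Sparse T?
  sparse-resp S? T? (d , B , x₀ , bound) = d , B , x₀ , λ x x₀≤x →
    subst (_≤ B * ⌊log₂ x ⌋ ^ d) (cong length (filter-≐ S? T? S≐T (upTo (suc x)))) (bound x x₀≤x)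

-- The algorithm works with the set read off the automaton; the recognised set is merely equivalent
-- to it and comes with another decision procedure.
isCorrectOutput-resp : ∀ {S T : Pred ℕ 0ℓ} → S ≐ T → (S? : Decidable S) (T? : Decidable T) →
                       ∀ output → IsCorrectOutput S? output → IsCorrectOutput T? output
isCorrectOutput-resp S≐T S? T? nothing fails (¬sparse , isGCD) =
  fails (¬sparse ∘ sparse-resp S≐T S? T? , isGCD-resp (swap S≐T) isGCD)
isCorrectOutput-resp S≐T S? T? (just (N , M))
  ((¬sparse , isGCD) , ((M′ , all) , N-least) , all′ , M-least) =
  (¬sparse ∘ sparse-resp (swap S≐T) T? S? , isGCD-resp S≐T isGCD) ,
  ((M′ , λ n M′≤n → isSum-resp S≐T (all n M′≤n)) ,
   λ N′ (M″ , all″) → N-least N′ (M″ , λ n M″≤n → isSum-resp (swap S≐T) (all″ n M″≤n))) ,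
  (λ n M≤n → isSum-resp S≐T (all′ n M≤n)) ,
  λ M′ all″ → M-least M′ (λ n M′≤n → isSum-resp (swap S≐T) (all″ n M′≤n))

theorem1p2 : Σ ((k : ℕ) → DFA k → Maybe (ℕ × ℕ)) λ algorithm →
    ∀ (k : ℕ) (2≤k : 2 ≤ k) (S : Pred ℕ 0ℓ) (A : DFA k) (rec : A Recognises S) →
    IsCorrectOutput (recognised⇒decidable 2≤k A rec) (algorithm k A)
theorem1p2 = (λ k A → run A (2 ≤? k)) , λ k 2≤k S A rec → correct 2≤k A rec (2 ≤? k)
  where
  run : ∀ {k} → DFA k → Dec (2 ≤ k) → Maybe (ℕ × ℕ)
  run A (yes 2≤k) = proj₁ (Main.solve 2≤k A)
  -- A default value; the specification concerns bases from 2 on.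
  run A (no _)    = nothing

  correct : ∀ {k} (2≤k : 2 ≤ k) {S : Pred ℕ 0ℓ} (A : DFA k) (rec : A Recognises S) (2≤?k : Dec (2 ≤ k)) →
            IsCorrectOutput (recognised⇒decidable 2≤k A rec) (run A 2≤?k)
  correct 2≤k A rec (no 2≰k)   = contradiction 2≤k 2≰k
  correct 2≤k A rec (yes 2≤k′) = isCorrectOutput-resp
    ( (λ {n} → FromDFA.accepted⇒recognised 2≤k′ A rec n)
    , (λ {n} → FromDFA.recognised⇒accepted 2≤k′ A rec n))
    (Main.S? 2≤k′ A) (recognised⇒decidable 2≤k A rec)
    (proj₁ (Main.solve 2≤k′ A)) (proj₂ (Main.solve 2≤k′ A))
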